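{- Let $T$ be a finite tree of order at least $3$. Then $T$ is $3$-critical with $\mathrm{sd}(T)=3$ if and only if $T$ is isomorphic to the path $P_{3k+1}$ for some integer $k\ge 1$.
   Context: All graphs are finite and simple; $P_n$ is the path on $n$ vertices. A set $D\subseteq V(G)$ is dominating if every vertex of $V(G)\setminus D$ has a neighbour in $D$; $\gamma(G)$ is the minimum cardinality of a dominating set of $G$. For $F\subseteq E(G)$, $G_F$ denotes the graph obtained from $G$ by subdividing each edge of $F$ exactly once (each edge $uv\in F$ is replaced by a path $u,w,v$ with a new vertex $w$). For an integer $q\ge 1$, a connected graph $G$ of order at least $3$ is called $q$-critical ($\gamma$-$q$-critical) if $\gamma(G_F)>\gamma(G)$ for every $F\subseteq E(G)$ with $|F|=q$, and there is a set $F'\subseteq E(G)$ with $|F'|=q-1$ such that $\gamma(G_{F'})=\gamma(G)$. The domination subdivision number $\mathrm{sd}(G)$ is the minimum cardinality of a set $F\subseteq E(G)$ such that $\gamma(G_F)>\gamma(G)$. -}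

module Defs where

open import Data.Nat.Base using (ℕ; zero; suc; pred; _+_; _≤_; _>_; z≤n; s≤s; NonZero)
open import Data.Nat.Properties using (1+n≢n)
import Data.Nat.Properties as ℕ
open import Data.Fin.Base as Fin using (Fin; toℕ; splitAt)
open import Data.Fin.Properties as Fin using (all?; any?)
open import Data.Fin.Subset using (Subset; _∈_; _∉_; ⊤; ∣_∣)
open import Data.Fin.Subset.Properties using (_∈?_; anySubset?; ∈⊤)
open import Data.List.Base using (List; _∷_; _∷ʳ_; length; lookup)
open import Data.List.Membership.Propositional using () renaming (_∈_ to _∈ˡ_)
import Data.List.Membership.DecPropositional as DecMembership
open import Data.List.Relation.Unary.All using (All)
open import Data.List.Relation.Unary.Linked using (Linked)
open import Data.List.Relation.Unary.Unique.Propositional using (Unique)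
open import Data.Product.Base using (Σ; ∃; ∃-syntax; _×_; _,_; proj₁; proj₂)
open import Data.Product.Properties using (≡-dec)
open import Data.Sum.Base as Sum using (_⊎_; inj₁; inj₂)
open import Data.Empty using (⊥; ⊥-elim)
open import Function.Bundles using (_↔_; _⇔_; Inverse)
open import Level using (0ℓ)
open import Relation.Nullary using (Dec; yes; no; ¬_; ¬?)
open import Relation.Nullary.Decidable using (_×-dec_; _→-dec_; _⊎-dec_)
open import Relation.Unary using (Pred) renaming (Decidable to Decidable₁)
open import Relation.Binary.Core using (Rel)
open import Relation.Binary.Definitions using (Decidable; Symmetric)
open import Relation.Binary.Construct.Closure.ReflexiveTransitive using (Star)
open import Relation.Binary.PropositionalEquality using (_≡_; refl)

IsMinimum : Pred ℕ 0ℓ → ℕ → Set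
IsMinimum P k = P k × (∀ j → P j → k ≤ j)

minimum : {P : Pred ℕ 0ℓ} → Decidable₁ P → ∀ n → P n → ∃ (IsMinimum P)
minimum P? zero    P0 = 0 , P0 , λ _ _ → z≤n
minimum P? (suc n) Pn with P? 0
... | yes P0 = 0 , P0 , λ _ _ → z≤n
... | no ¬P0 with minimum (λ k → P? (suc k)) n Pn
...   | k , Pk , least = suc k , Pk , λ where
        zero    P0 → ⊥-elim (¬P0 P0)
        (suc j) Pj → s≤s (least j Pj)

record Graph : Set₁ where
  field
    order     : ℕ
    Adj       : Rel (Fin order) 0ℓ
    adj?      : Decidable Adj
    symmetric : Symmetric Adj
    loopless  : ∀ v → ¬ Adj v v

  Vertex : Set
  Vertex = Fin order

open Graph public using (order; Vertex)

_[_~_] : (G : Graph) → Vertex G → Vertex G → Set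
G [ u ~ v ] = Graph.Adj G u v

record _≅_ (G H : Graph) : Set where
  field
    bijection : Vertex G ↔ Vertex H
    preserves : ∀ u v → G [ u ~ v ] ⇔ H [ Inverse.to bijection u ~ Inverse.to bijection v ]

Path : ℕ → Graph
Path n = record
  { order     = n
  ; Adj       = λ u v → suc (toℕ u) ≡ toℕ v ⊎ suc (toℕ v) ≡ toℕ u
  ; adj?      = λ u v → (suc (toℕ u) ℕ.≟ toℕ v) ⊎-dec (suc (toℕ v) ℕ.≟ toℕ u)
  ; symmetric = Sum.swap
  ; loopless  = λ v → Sum.[ 1+n≢n , 1+n≢n ]
  }

Connected : Graph → Set
Connected G = ∀ u v → Star (Graph.Adj G) u v

-- The cycle v, x, xs…, w, v; the intermediate x makes its length at least 3.
Cycle : Graph → Set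
Cycle G = ∃[ v ] ∃[ x ] ∃[ xs ] ∃[ w ]
  let vs = v ∷ x ∷ xs ∷ʳ w in
  Unique vs × Linked (Graph.Adj G) vs × G [ w ~ v ]

record IsTree (G : Graph) : Set where
  field
    connected : Connected G
    acyclic   : ¬ Cycle G

Dominating : (G : Graph) → Subset (order G) → Set
Dominating G D = ∀ v → v ∉ D → ∃[ u ] u ∈ D × G [ v ~ u ]

dominating? : ∀ G → Decidable₁ (Dominating G)
dominating? G D =
  all? λ v → ¬? (v ∈? D) →-dec any? λ u → (u ∈? D) ×-dec Graph.adj? G v u

HasDominatingSetOfSize : Graph → ℕ → Set
HasDominatingSetOfSize G k = ∃[ D ] Dominating G D × ∣ D ∣ ≡ k

γ-minimum : ∀ G → ∃ (IsMinimum (HasDominatingSetOfSize G))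
γ-minimum G = minimum
  (λ k → anySubset? λ D → dominating? G D ×-dec (∣ D ∣ ℕ.≟ k))
  ∣ ⊤ {order G} ∣ (⊤ , (λ v v∉⊤ → ⊥-elim (v∉⊤ ∈⊤)) , refl)

γ : Graph → ℕ
γ G = proj₁ (γ-minimum G)

-- A set F ⊆ E(G), listed without repetition.  Since an edge {u , v} is stored
-- only as the pair (u , v) with u < v, the length of the list is |F|.
record EdgeSet (G : Graph) : Set where
  field
    list   : List (Vertex G × Vertex G)
    edges  : All (λ (u , v) → u Fin.< v × G [ u ~ v ]) list
    unique : Unique list

  size : ℕ
  size = length list

  Contains : Rel (Vertex G) 0ℓ
  Contains u v = (u , v) ∈ˡ list ⊎ (v , u) ∈ˡ list

  contains? : Decidable Contains
  contains? u v = ((u , v) ∈ˡ? list) ⊎-dec ((v , u) ∈ˡ? list)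
    where open DecMembership (≡-dec Fin._≟_ Fin._≟_) renaming (_∈?_ to _∈ˡ?_)

  EndOf : Vertex G → Fin size → Set
  EndOf v i = let (a , b) = lookup list i in v ≡ a ⊎ v ≡ b

  endOf? : ∀ v i → Dec (EndOf v i)
  endOf? v i = let (a , b) = lookup list i in (v Fin.≟ a) ⊎-dec (v Fin.≟ b)

open EdgeSet public using (size)

-- The first `order G` vertices are the vertices of G; the i-th vertex after
-- them is the one subdividing the i-th edge in F.
module Subdivision (G : Graph) (F : EdgeSet G) where
  open EdgeSet F using (Contains; contains?; EndOf; endOf?)

  SubdividedAdj : Rel (Vertex G ⊎ Fin (size F)) 0ℓ
  SubdividedAdj (inj₁ u) (inj₁ v) = G [ u ~ v ] × ¬ Contains u v
  SubdividedAdj (inj₁ u) (inj₂ i) = EndOf u i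
  SubdividedAdj (inj₂ i) (inj₁ v) = EndOf v i
  SubdividedAdj (inj₂ i) (inj₂ j) = ⊥

  subdividedAdj? : Decidable SubdividedAdj
  subdividedAdj? (inj₁ u) (inj₁ v) = Graph.adj? G u v ×-dec ¬? (contains? u v)
  subdividedAdj? (inj₁ u) (inj₂ i) = endOf? u i
  subdividedAdj? (inj₂ i) (inj₁ v) = endOf? v i
  subdividedAdj? (inj₂ i) (inj₂ j) = no λ ()

  subdividedAdj-sym : Symmetric SubdividedAdj
  subdividedAdj-sym {inj₁ u} {inj₁ v} (u~v , uv∉F) =
    Graph.symmetric G u~v , λ vu∈F → uv∉F (Sum.swap vu∈F)
  subdividedAdj-sym {inj₁ u} {inj₂ i} e = e
  subdividedAdj-sym {inj₂ i} {inj₁ v} e = e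

  subdividedAdj-loopless : ∀ x → ¬ SubdividedAdj x x
  subdividedAdj-loopless (inj₁ v) (v~v , _) = Graph.loopless G v v~v

  subdivision : Graph
  subdivision = record
    { order     = order G + size F
    ; Adj       = λ x y → SubdividedAdj (splitAt (order G) x) (splitAt (order G) y)
    ; adj?      = λ x y → subdividedAdj? (splitAt (order G) x) (splitAt (order G) y)
    ; symmetric = λ {x} {y} →
        subdividedAdj-sym {splitAt (order G) x} {splitAt (order G) y}
    ; loopless  = λ x → subdividedAdj-loopless (splitAt (order G) x)
    }

subdivide : (G : Graph) → EdgeSet G → Graph
subdivide = Subdivision.subdivision

record IsCritical (q : ℕ) .{{_ : NonZero q}} (G : Graph) : Set where
  field
    connected : Connected G
    order≥3   : 3 ≤ order G
    increases : ∀ (F : EdgeSet G) → size F ≡ q → γ (subdivide G F) > γ G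
    preserves : Σ (EdgeSet G) λ F → size F ≡ pred q × γ (subdivide G F) ≡ γ G

-- sd(G) = k, as a relation because γ never increases on an edgeless graph.
SubdivisionNumber : Graph → ℕ → Set
SubdivisionNumber G =
  IsMinimum λ k → Σ (EdgeSet G) λ F → size F ≡ k × γ (subdivide G F) > γ G

-- Contracting each subdividing vertex into an end of its edge shows γ(T) ≤ γ(T_F),
-- and contracting pendant edges into their leaves shows that γ survives the
-- subdivision of a set of pendant edges exactly when some minimum dominating set
-- contains all their leaves.  Suppose a vertex m has three neighbours; each of them
-- begins a branch with a leaf.  As no two edges raise γ, every two of these leaves lie
-- in a common minimum dominating set; subdividing a leaf edge together with the edge
-- from m into its branch yields further minimum dominating sets.  Two minimum
-- dominating sets can be spliced along a branch at m whenever both splices dominate,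
-- since neither splice is smaller than γ; this produces one containing all three
-- leaves, so that subdividing three pendant edges does not raise γ.  Hence T is a path
-- on n vertices, where γ(T_F) = ⌈(n + |F|) / 3⌉.

{-# OPTIONS --safe #-}
module Submission where

open import Defs
open import Data.Nat.Base using (ℕ; zero; suc; _+_; _*_; _≤_; _<_; z≤n; s≤s)
import Data.Nat.Properties as ℕ
open import Data.Nat.Solver using (module +-*-Solver)
open import Data.Nat.DivMod using (_divMod_; result)
open import Data.Fin.Base as Fin using (Fin; zero; suc; toℕ; splitAt; join; fromℕ<)
import Data.Fin.Properties as Fin
open import Data.Fin.Subset as Subset using (Subset; inside; outside; ⁅_⁆; _∪_; ∣_∣)
import Data.Fin.Subset.Properties as Subset
open import Data.Fin.Permutation using (↔⇒≡)
open import Data.Vec.Base using ([]; _∷_; here; there)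
open import Data.List.Base
  using (List; []; _∷_; _++_; length; lookup; map; concatMap; allFin; filter; _∷ʳ_)
import Data.List.Properties as List
open import Data.List.Membership.Propositional using (_∈_; _∉_)
open import Data.List.Membership.Propositional.Properties
  using (∈-lookup; ∈-allFin; ∈-map⁺; ∈-++⁺ˡ; ∈-++⁺ʳ; ∈-concatMap⁺; ∈-filter⁺; ∈-filter⁻; ∈-++⁻)
open import Data.List.Relation.Unary.Any as Any using (here; there)
open import Data.List.Relation.Unary.Any.Properties using (lookup-index)
open import Data.List.Relation.Unary.All as All using (All; []; _∷_)
open import Data.List.Relation.Unary.AllPairs as AllPairs using (AllPairs; []; _∷_)
open import Data.List.Relation.Unary.Linked as Linked using (Linked; []; [-]; _∷_)
open import Data.List.Relation.Unary.Unique.Propositional using (Unique)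
import Data.List.Relation.Unary.Unique.Propositional.Properties as Unique
import Data.List.Relation.Unary.All.Properties as All
import Data.List.Relation.Unary.AllPairs.Properties as AllPairs
import Data.List.Membership.DecPropositional as DecMembership
open import Data.Product.Base using (Σ; ∃; ∃-syntax; _×_; _,_; proj₁; proj₂)
open import Data.Sum.Base as Sum using (_⊎_; inj₁; inj₂)
open import Data.Unit.Base using (⊤; tt)
open import Function.Base using (_∘_; id)
open import Function.Bundles using (_⇔_; mk⇔; Inverse; mk↔ₛ′; Equivalence)
open import Level using (0ℓ)
open import Relation.Nullary using (Dec; yes; no; ¬_; ¬?; contradiction)
open import Relation.Unary using () renaming (Decidable to Decidable₁)
open import Relation.Binary.Core using (Rel)
open import Relation.Binary.PropositionalEquality
  using (_≡_; _≢_; refl; sym; trans; cong; cong₂; subst; subst₂; ≢-sym)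
open import Relation.Nullary.Decidable using (_×-dec_)
open import Relation.Binary.Definitions using (tri<; tri≈; tri>)
open import Relation.Binary.Construct.Closure.ReflexiveTransitive
  using (Star; ε; _◅_; _◅◅_; reverse)

-- Dominating lists

lookup-injective : ∀ {A : Set} {xs : List A} → Unique xs →
                   ∀ {i j} → lookup xs i ≡ lookup xs j → i ≡ j
lookup-injective (x∉ ∷ uniq) {zero}  {zero}  eq = refl
lookup-injective (x∉ ∷ uniq) {zero}  {suc j} eq = contradiction eq (All.lookup x∉ (∈-lookup j))
lookup-injective (x∉ ∷ uniq) {suc i} {zero}  eq = contradiction (sym eq) (All.lookup x∉ (∈-lookup i))
lookup-injective (x∉ ∷ uniq) {suc i} {suc j} eq = cong suc (lookup-injective uniq eq)

Unique-⊆⇒length≤ : ∀ {A : Set} {xs ys : List A} → Unique xs →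
                   (∀ {x} → x ∈ xs → x ∈ ys) → length xs ≤ length ys
Unique-⊆⇒length≤ {xs = xs} {ys} uniq xs⊆ys = Fin.injective⇒≤ {f = position} position-injective
  where
  position : Fin (length xs) → Fin (length ys)
  position i = Any.index (xs⊆ys (∈-lookup i))

  position-injective : ∀ {i j} → position i ≡ position j → i ≡ j
  position-injective {i} {j} eq = lookup-injective uniq
    (trans (lookup-index (xs⊆ys (∈-lookup i)))
    (trans (cong (lookup ys) eq) (sym (lookup-index (xs⊆ys (∈-lookup j))))))

length-allFin : ∀ n → length (allFin n) ≡ n
length-allFin n = List.length-tabulate id

Unique⇒length≤ : ∀ {n} {xs : List (Fin n)} → Unique xs → length xs ≤ n
Unique⇒length≤ {n} uniq =
  ℕ.≤-trans (Unique-⊆⇒length≤ uniq (λ {x} _ → ∈-allFin x)) (ℕ.≤-reflexive (length-allFin n))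

complete⇒≤length : ∀ {n} {xs : List (Fin n)} → (∀ v → v ∈ xs) → n ≤ length xs
complete⇒≤length {n} all∈ =
  ℕ.≤-trans (ℕ.≤-reflexive (sym (length-allFin n)))
            (Unique-⊆⇒length≤ (Unique.allFin⁺ n) (λ {x} _ → all∈ x))

elements : ∀ {n} → Subset n → List (Fin n)
elements []            = []
elements (inside  ∷ p) = zero ∷ map suc (elements p)
elements (outside ∷ p) = map suc (elements p)

length-elements : ∀ {n} (p : Subset n) → length (elements p) ≡ ∣ p ∣
length-elements []            = refl
length-elements (inside  ∷ p) = cong suc (trans (List.length-map suc (elements p)) (length-elements p))
length-elements (outside ∷ p) = trans (List.length-map suc (elements p)) (length-elements p)

∈-elements : ∀ {n} {p : Subset n} {x} → x Subset.∈ p → x ∈ elements p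
∈-elements {p = inside  ∷ p} here        = here refl
∈-elements {p = inside  ∷ p} (there x∈p) = there (∈-map⁺ suc (∈-elements x∈p))
∈-elements {p = outside ∷ p} (there x∈p) = ∈-map⁺ suc (∈-elements x∈p)

fromList : ∀ {n} → List (Fin n) → Subset n
fromList []       = Subset.⊥
fromList (x ∷ xs) = ⁅ x ⁆ ∪ fromList xs

∈-fromList : ∀ {n} {xs : List (Fin n)} {x} → x ∈ xs → x Subset.∈ fromList xs
∈-fromList (here refl) = Subset.x∈p∪q⁺ (inj₁ (Subset.x∈⁅x⁆ _))
∈-fromList (there x∈)  = Subset.x∈p∪q⁺ (inj₂ (∈-fromList x∈))

∣⁅x⁆∪p∣≤1+∣p∣ : ∀ {n} (x : Fin n) (p : Subset n) → ∣ ⁅ x ⁆ ∪ p ∣ ≤ suc ∣ p ∣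
∣⁅x⁆∪p∣≤1+∣p∣ zero    (s ∷ p) = s≤s (ℕ.≤-trans
  (ℕ.≤-reflexive (cong ∣_∣ (Subset.∪-identityˡ p))) (Subset.∣p∣≤∣x∷p∣ s p))
∣⁅x⁆∪p∣≤1+∣p∣ (suc x) (inside  ∷ p) = s≤s (∣⁅x⁆∪p∣≤1+∣p∣ x p)
∣⁅x⁆∪p∣≤1+∣p∣ (suc x) (outside ∷ p) = ∣⁅x⁆∪p∣≤1+∣p∣ x p

∣fromList∣≤length : ∀ {n} (xs : List (Fin n)) → ∣ fromList xs ∣ ≤ length xs
∣fromList∣≤length {n} [] = ℕ.≤-reflexive (Subset.∣⊥∣≡0 n)
∣fromList∣≤length (x ∷ xs) =
  ℕ.≤-trans (∣⁅x⁆∪p∣≤1+∣p∣ x (fromList xs)) (s≤s (∣fromList∣≤length xs))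

-- Repetitions are allowed: only upper bounds on lengths matter.
DominatingList : {A : Set} → Rel A 0ℓ → List A → Set
DominatingList R xs = ∀ v → v ∈ xs ⊎ ∃[ u ] u ∈ xs × R v u

γ≤length : ∀ G {xs} → DominatingList (G [_~_]) xs → γ G ≤ length xs
γ≤length G {xs} dom = ℕ.≤-trans
  (proj₂ (proj₂ (γ-minimum G)) ∣ fromList xs ∣ (fromList xs , dominating , refl))
  (∣fromList∣≤length xs)
  where
  dominating : Dominating G (fromList xs)
  dominating v v∉ with dom v
  ... | inj₁ v∈             = contradiction (∈-fromList v∈) v∉
  ... | inj₂ (u , u∈ , v~u) = u , ∈-fromList u∈ , v~u

γ-list : ∀ G → ∃[ xs ] DominatingList (G [_~_]) xs × length xs ≡ γ G
γ-list G with γ-minimum G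
... | _ , (D , dominating , refl) , _ = elements D , dom , length-elements D
  where
  dom : DominatingList (G [_~_]) (elements D)
  dom v with v Subset.∈? D
  ... | yes v∈D = inj₁ (∈-elements v∈D)
  ... | no  v∉D with dominating v v∉D
  ...   | u , u∈D , v~u = inj₂ (u , ∈-elements u∈D , v~u)

module _ {A : Set} {R : Rel A 0ℓ} where

  -- Each entry of a dominating list covers only itself and its at most two neighbours, so the balls
  -- around the entries contain everything. The injection `to` lets the count run over `Fin n` while
  -- `R` lives on a sum type.
  order≤3*length : ∀ {n} (to : Fin n → A) → (∀ {x y} → to x ≡ to y → x ≡ y) →
    (∀ v → ∃[ a ] ∃[ b ] (∀ u → R u v → u ≡ a ⊎ u ≡ b)) →
    ∀ {xs} → DominatingList R xs → n ≤ 3 * length xs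
  order≤3*length {n} to to-injective two {xs} dom =
    ℕ.≤-trans (ℕ.≤-reflexive (sym (trans (List.length-map to (allFin n)) (length-allFin n))))
    (ℕ.≤-trans (Unique-⊆⇒length≤ {xs = map to (allFin n)} {ys = concatMap ball xs}
                  (Unique.map⁺ to-injective (Unique.allFin⁺ n)) (λ {v} _ → covered v))
               (ℕ.≤-reflexive (length-balls xs)))
    where
    ball : A → List A
    ball v = let a , b , _ = two v in v ∷ a ∷ b ∷ []

    length-balls : ∀ ys → length (concatMap ball ys) ≡ 3 * length ys
    length-balls []       = refl
    length-balls (y ∷ ys) = trans (cong (3 +_) (length-balls ys)) (sym (ℕ.*-suc 3 (length ys)))

    covered : ∀ v → v ∈ concatMap ball xs
    covered v with dom v
    ... | inj₁ v∈ = ∈-concatMap⁺ ball (Any.map (λ { refl → here refl }) v∈)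
    ... | inj₂ (u , u∈ , v~u) = ∈-concatMap⁺ ball (Any.map near u∈)
      where
      near : ∀ {x} → u ≡ x → v ∈ ball x
      near refl with proj₂ (proj₂ (two u)) v v~u
      ... | inj₁ v≡a = there (here v≡a)
      ... | inj₂ v≡b = there (there (here v≡b))

  module _ (R-sym : ∀ {x y} → R x y → R y x) where

    -- On a path, the middle of each block of three dominates the block; a last block of one or two
    -- is dominated by its first entry. This attains the bound of `order≤3*length`, rounded up.
    everyThird : List A → List A
    everyThird []               = []
    everyThird (x ∷ [])         = x ∷ []
    everyThird (x ∷ y ∷ [])     = x ∷ []
    everyThird (x ∷ y ∷ z ∷ xs) = y ∷ everyThird xs

    everyThird-length : ∀ xs m → length xs ≤ 3 * m → length (everyThird xs) ≤ m
    everyThird-length []               m       _ = z≤n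
    everyThird-length (x ∷ [])         (suc m) _ = s≤s z≤n
    everyThird-length (x ∷ y ∷ [])     (suc m) _ = s≤s z≤n
    everyThird-length (x ∷ y ∷ z ∷ xs) (suc m) h = s≤s (everyThird-length xs m
      (ℕ.+-cancelˡ-≤ 3 _ _ (ℕ.≤-trans h (ℕ.≤-reflexive (ℕ.*-suc 3 m)))))

    everyThird-dominates : ∀ {xs} → Linked R xs → ∀ {v} → v ∈ xs →
      v ∈ everyThird xs ⊎ ∃[ u ] u ∈ everyThird xs × R v u
    everyThird-dominates [-]              (here refl)                 = inj₁ (here refl)
    everyThird-dominates (_ ∷ [-])        (here refl)                 = inj₁ (here refl)
    everyThird-dominates (x~y ∷ [-])      (there (here refl))         = inj₂ (_ , here refl , R-sym x~y)
    everyThird-dominates (x~y ∷ _ ∷ _)    (here refl)                 = inj₂ (_ , here refl , x~y)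
    everyThird-dominates (_ ∷ _ ∷ _)      (there (here refl))         = inj₁ (here refl)
    everyThird-dominates (_ ∷ y~z ∷ _)    (there (there (here refl))) = inj₂ (_ , here refl , R-sym y~z)
    everyThird-dominates (_ ∷ _ ∷ linked) (there (there (there v∈))) =
      Sum.map there (λ { (u , u∈ , v~u) → u , there u∈ , v~u })
        (everyThird-dominates (Linked.tail linked) v∈)

  linked⇒dominatingList : (∀ {x y} → R x y → R y x) → ∀ {xs} → Linked R xs → (∀ v → v ∈ xs) →
    ∀ {m} → length xs ≤ 3 * m → ∃[ ys ] DominatingList R ys × length ys ≤ m
  linked⇒dominatingList R-sym {xs} linked all∈ {m} h =
    everyThird R-sym xs , (λ v → everyThird-dominates R-sym linked (all∈ v)) ,
    everyThird-length R-sym xs m h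

-- Subdivided graphs

_EndsAt_ : ∀ {A : Set} → A → A × A → Set
v EndsAt (a , b) = v ≡ a ⊎ v ≡ b

data Consecutive {A : Set} (a b : A) : List A → Set where
  here  : ∀ {xs} → Consecutive a b (a ∷ b ∷ xs)
  there : ∀ {x xs} → Consecutive a b xs → Consecutive a b (x ∷ xs)

-- The candidates `a` and `b` may coincide and need not be adjacent to `v`, so degrees 0 and 1 are
-- included.
AtMostTwoNeighbours : (G : Graph) → Vertex G → Set
AtMostTwoNeighbours G v = ∃[ a ] ∃[ b ] (∀ u → G [ u ~ v ] → u ≡ a ⊎ u ≡ b)

module _ (G : Graph) where

  open Graph G using () renaming (symmetric to ~-sym)

  ~⇒≢ : ∀ {u v} → G [ u ~ v ] → u ≢ v
  ~⇒≢ u~u refl = Graph.loopless G _ u~u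

  orient : Vertex G × Vertex G → Vertex G × Vertex G
  orient (a , b) with Fin.<-cmp a b
  ... | tri> _ _ _ = b , a
  ... | _          = a , b

  endsAt-orient⁻ : ∀ {v} e → v EndsAt orient e → v EndsAt e
  endsAt-orient⁻ (a , b) end with Fin.<-cmp a b
  ... | tri< _ _ _ = end
  ... | tri≈ _ _ _ = end
  ... | tri> _ _ _ = Sum.swap end

  endsAt-orient⁺ : ∀ {v} e → v EndsAt e → v EndsAt orient e
  endsAt-orient⁺ (a , b) end with Fin.<-cmp a b
  ... | tri< _ _ _ = end
  ... | tri≈ _ _ _ = end
  ... | tri> _ _ _ = Sum.swap end

  orient-edge : ∀ {(a , b) : Vertex G × Vertex G} → G [ a ~ b ] →
                let (u , v) = orient (a , b) in u Fin.< v × G [ u ~ v ]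
  orient-edge {a , b} a~b with Fin.<-cmp a b
  ... | tri< a<b _ _ = a<b , a~b
  ... | tri≈ _ a≡b _ = contradiction a≡b (~⇒≢ a~b)
  ... | tri> _ _ b<a = b<a , ~-sym a~b

  -- Inequality of edges as unordered pairs: an end of one edge off the other survives `orient`,
  -- whereas `e ≢ f` does not, since a pair and its reversal have the same orientation.
  Distinguished : Rel (Vertex G × Vertex G) 0ℓ
  Distinguished e f = ∃[ v ] v EndsAt e × ¬ v EndsAt f

  edgeSet : (es : List (Vertex G × Vertex G)) → All (λ (a , b) → G [ a ~ b ]) es →
            AllPairs Distinguished es → EdgeSet G
  edgeSet es edges distinct = record
    { list   = map orient es
    ; edges  = All.map⁺ (All.map orient-edge edges)
    ; unique = AllPairs.map⁺ (AllPairs.map orient-≢ distinct)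
    }
    where
    orient-≢ : ∀ {e f} → Distinguished e f → orient e ≢ orient f
    orient-≢ {e} {f} (v , end , ¬end) eq =
      ¬end (endsAt-orient⁻ f (subst (v EndsAt_) eq (endsAt-orient⁺ e end)))

module _ (G : Graph) (F : EdgeSet G) where

  open Graph G using () renaming (symmetric to ~-sym)
  open EdgeSet F using (list; edges; unique; Contains; EndOf; endOf?)
  open Subdivision G F using (SubdividedAdj; subdividedAdj-sym)

  -- With its converse `γ-subdivide-list`, this moves all later arguments from the numbered vertices
  -- of `subdivide G F` to `SubdividedAdj` on the sum type.
  γ-subdivide≤length : ∀ {ys} → DominatingList SubdividedAdj ys → γ (subdivide G F) ≤ length ys
  γ-subdivide≤length {ys} dom = ℕ.≤-trans
    (γ≤length (subdivide G F) {map join′ ys} dominates)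
    (ℕ.≤-reflexive (List.length-map join′ ys))
    where
    join′ = join (order G) (size F)

    dominates : DominatingList (subdivide G F [_~_]) (map join′ ys)
    dominates v with dom (splitAt (order G) v)
    ... | inj₁ v∈ = inj₁ (subst (_∈ _) (Fin.join-splitAt (order G) _ v) (∈-map⁺ join′ v∈))
    ... | inj₂ (u , u∈ , v~u) = inj₂ (join′ u , ∈-map⁺ join′ u∈ ,
      subst (SubdividedAdj _) (sym (Fin.splitAt-join (order G) _ u)) v~u)

  γ-subdivide-list : ∃[ ys ] DominatingList SubdividedAdj ys × length ys ≡ γ (subdivide G F)
  γ-subdivide-list with γ-list (subdivide G F)
  ... | xs , dom , len = map split xs , dominates , trans (List.length-map split xs) len
    where
    split = splitAt (order G) {size F}

    dominates : DominatingList SubdividedAdj (map split xs)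
    dominates v with dom (join (order G) (size F) v)
    ... | inj₁ v∈ = inj₁ (subst (_∈ _) (Fin.splitAt-join (order G) _ v) (∈-map⁺ split v∈))
    ... | inj₂ (u , u∈ , v~u) = inj₂ (split u , ∈-map⁺ split u∈ ,
      subst (λ x → SubdividedAdj x (split u)) (Fin.splitAt-join (order G) _ v) v~u)

  edge-ordered : ∀ i → let (a , b) = lookup list i in a Fin.< b × G [ a ~ b ]
  edge-ordered i = All.lookup edges (∈-lookup i)

  ends-adjacent : ∀ {u v} i → EndOf u i → EndOf v i → u ≡ v ⊎ G [ u ~ v ]
  ends-adjacent i (inj₁ refl) (inj₁ refl) = inj₁ refl
  ends-adjacent i (inj₁ refl) (inj₂ refl) = inj₂ (proj₂ (edge-ordered i))
  ends-adjacent i (inj₂ refl) (inj₁ refl) = inj₂ (~-sym (proj₂ (edge-ordered i)))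
  ends-adjacent i (inj₂ refl) (inj₂ refl) = inj₁ refl

  ends-contained : ∀ {u v} i → u ≢ v → EndOf u i → EndOf v i → Contains u v
  ends-contained i u≢v (inj₁ refl) (inj₁ refl) = contradiction refl u≢v
  ends-contained i u≢v (inj₁ refl) (inj₂ refl) = inj₁ (∈-lookup i)
  ends-contained i u≢v (inj₂ refl) (inj₁ refl) = inj₂ (∈-lookup i)
  ends-contained i u≢v (inj₂ refl) (inj₂ refl) = contradiction refl u≢v

  ends-cover : ∀ {u v w i} → u ≢ v → EndOf u i → EndOf v i → EndOf w i → w ≡ u ⊎ w ≡ v
  ends-cover u≢v (inj₁ p) (inj₁ q) _        = contradiction (trans p (sym q)) u≢v
  ends-cover u≢v (inj₂ p) (inj₂ q) _        = contradiction (trans p (sym q)) u≢v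
  ends-cover u≢v (inj₁ p) (inj₂ q) (inj₁ r) = inj₁ (trans r (sym p))
  ends-cover u≢v (inj₁ p) (inj₂ q) (inj₂ r) = inj₂ (trans r (sym q))
  ends-cover u≢v (inj₂ p) (inj₁ q) (inj₁ r) = inj₂ (trans r (sym q))
  ends-cover u≢v (inj₂ p) (inj₁ q) (inj₂ r) = inj₁ (trans r (sym p))

  contained-ends : ∀ {u v} → Contains u v → ∃[ i ] EndOf u i × EndOf v i
  contained-ends (inj₁ uv∈) = Any.index uv∈ ,
    inj₁ (cong proj₁ (lookup-index uv∈)) , inj₂ (cong proj₂ (lookup-index uv∈))
  contained-ends (inj₂ vu∈) = Any.index vu∈ ,
    inj₂ (cong proj₂ (lookup-index vu∈)) , inj₁ (cong proj₁ (lookup-index vu∈))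

  ends-injective : ∀ {u v i j} → u ≢ v → EndOf u i → EndOf v i → EndOf u j → EndOf v j → i ≡ j
  ends-injective {i = i} {j} u≢v ui vi uj vj = lookup-injective unique (equal ui vi uj vj)
    where
    equal : EndOf _ i → EndOf _ i → EndOf _ j → EndOf _ j → lookup list i ≡ lookup list j
    equal (inj₁ p) (inj₁ q) _ _ = contradiction (trans p (sym q)) u≢v
    equal (inj₂ p) (inj₂ q) _ _ = contradiction (trans p (sym q)) u≢v
    equal _ _ (inj₁ p) (inj₁ q) = contradiction (trans p (sym q)) u≢v
    equal _ _ (inj₂ p) (inj₂ q) = contradiction (trans p (sym q)) u≢v
    equal (inj₁ p) (inj₂ q) (inj₁ r) (inj₂ s) with lookup list i | lookup list j
    ... | _ , _ | _ , _ with refl ← p | refl ← q | refl ← r | refl ← s = refl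
    equal (inj₂ p) (inj₁ q) (inj₂ r) (inj₁ s) with lookup list i | lookup list j
    ... | _ , _ | _ , _ with refl ← p | refl ← q | refl ← r | refl ← s = refl
    -- In the two crossed cases the pairs are reversals of each other, which is impossible because
    -- both are stored increasingly.
    equal (inj₁ refl) (inj₂ refl) (inj₂ r) (inj₁ s) = contradiction
      (subst₂ Fin._<_ r s (proj₁ (edge-ordered i))) (ℕ.<-asym (proj₁ (edge-ordered j)))
    equal (inj₂ refl) (inj₁ refl) (inj₁ r) (inj₂ s) = contradiction
      (subst₂ Fin._<_ s r (proj₁ (edge-ordered i))) (ℕ.<-asym (proj₁ (edge-ordered j)))

  Between : Vertex G → Vertex G → Set
  Between u v = ∃[ i ] EndOf u i × EndOf v i

  between? : ∀ u v → Dec (Between u v)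
  between? u v = Fin.any? λ i → endOf? u i ×-dec endOf? v i

  -- The ends of a subdivided edge are equal or adjacent to whichever end `f i` its new vertex is
  -- contracted into, so they stay dominated. The freedom in `f` later places chosen vertices in the
  -- list.
  contract-dominates : ∀ {f : Fin (size F) → Vertex G} → (∀ i → EndOf (f i) i) →
    ∀ {ys} → DominatingList SubdividedAdj ys → DominatingList (G [_~_]) (map Sum.[ id , f ] ys)
  contract-dominates {f} ends dom v with dom (inj₁ v)
  ... | inj₁ v∈ = inj₁ (∈-map⁺ Sum.[ id , f ] v∈)
  ... | inj₂ (inj₁ u , u∈ , v~u , _) = inj₂ (u , ∈-map⁺ Sum.[ id , f ] u∈ , v~u)
  ... | inj₂ (inj₂ i , i∈ , end) with ends-adjacent i end (ends i)
  ...   | inj₁ refl = inj₁ (∈-map⁺ Sum.[ id , f ] i∈)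
  ...   | inj₂ v~fi = inj₂ (f i , ∈-map⁺ Sum.[ id , f ] i∈ , v~fi)

  γ≤γ-subdivide : γ G ≤ γ (subdivide G F)
  γ≤γ-subdivide with γ-subdivide-list
  ... | ys , dom , len = ℕ.≤-trans
    (γ≤length G (contract-dominates {λ i → proj₁ (lookup list i)} (λ _ → inj₁ refl) dom))
    (ℕ.≤-reflexive (trans (List.length-map _ ys) len))

  other-end : ∀ {v} i → EndOf v i → ∃[ u ] G [ u ~ v ] × EndOf u i
  other-end i (inj₁ refl) = _ , ~-sym (proj₂ (edge-ordered i)) , inj₂ refl
  other-end i (inj₂ refl) = _ , proj₂ (edge-ordered i) , inj₁ refl

  -- Subdivision raises no degree of an old vertex: each neighbour `u` of `v` is replaced by
  -- `towards u`, the next vertex on the way from `v` to `u`. A new vertex sees only the two ends of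
  -- its edge.
  atMostTwo-subdivide : (∀ v → AtMostTwoNeighbours G v) →
    ∀ x → ∃[ a ] ∃[ b ] (∀ y → SubdividedAdj y x → y ≡ a ⊎ y ≡ b)
  atMostTwo-subdivide two (inj₂ i) = let (a , b) = lookup list i in inj₁ a , inj₁ b , λ where
    (inj₁ u) (inj₁ refl) → inj₁ refl
    (inj₁ u) (inj₂ refl) → inj₂ refl
  atMostTwo-subdivide two (inj₁ v) with two v
  ... | a , b , only = towards a , towards b , λ where
      (inj₁ u) (u~v , uv∉) → Sum.map (λ { refl → unsubdivided u~v uv∉ }) (λ { refl → unsubdivided u~v uv∉ })
                               (only u u~v)
      (inj₂ i) end → let u , u~v , end′ = other-end i end in
        Sum.map (λ { refl → subdivided u~v end end′ }) (λ { refl → subdivided u~v end end′ }) (only u u~v)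
    where
    towards : Vertex G → Vertex G ⊎ Fin (size F)
    towards u with between? v u
    ... | yes (i , _) = inj₂ i
    ... | no _        = inj₁ u

    unsubdivided : ∀ {u} → G [ u ~ v ] → ¬ Contains u v → inj₁ u ≡ towards u
    unsubdivided {u} u~v uv∉ with between? v u
    ... | yes (i , vi , ui) = contradiction (ends-contained i (~⇒≢ G u~v) ui vi) uv∉
    ... | no _              = refl

    subdivided : ∀ {u i} → G [ u ~ v ] → EndOf v i → EndOf u i → inj₂ i ≡ towards u
    subdivided {u} {i} u~v vi ui with between? v u
    ... | yes (j , vj , uj) = cong inj₂ (ends-injective (~⇒≢ G u~v) ui vi uj vj)
    ... | no none           = contradiction (i , vi , ui) none

  order≤3*γ-subdivide : (∀ v → AtMostTwoNeighbours G v) →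
                        order G + size F ≤ 3 * γ (subdivide G F)
  order≤3*γ-subdivide two with γ-subdivide-list
  ... | ys , dom , len = ℕ.≤-trans
    (order≤3*length (splitAt (order G)) split-injective (atMostTwo-subdivide two) dom)
    (ℕ.≤-reflexive (cong (3 *_) len))
    where
    split-injective : ∀ {x y} → splitAt (order G) {size F} x ≡ splitAt (order G) y → x ≡ y
    split-injective {x} {y} eq = trans (sym (Fin.join-splitAt (order G) _ x))
      (trans (cong (join (order G) (size F)) eq) (Fin.join-splitAt (order G) _ y))

  -- The path through the old vertices `x ∷ xs` with the subdividing vertices inserted. When a fresh
  -- head is put in front, `old⁻` and `new⁻` show that neither it nor the vertex on its edge occurs
  -- already; `old⁺` and `new⁺` later show that nothing is missed.
  record SubdividedPath (x : Vertex G) (xs : List (Vertex G)) : Set where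
    field
      rest   : List (Vertex G ⊎ Fin (size F))
      linked : Linked SubdividedAdj (inj₁ x ∷ rest)
      uniq   : Unique (inj₁ x ∷ rest)
      old⁺   : ∀ {v} → v ∈ x ∷ xs → inj₁ v ∈ inj₁ x ∷ rest
      old⁻   : ∀ {v} → inj₁ v ∈ inj₁ x ∷ rest → v ∈ x ∷ xs
      new⁺   : ∀ {a b} i → EndOf a i → EndOf b i → Consecutive a b (x ∷ xs) → inj₂ i ∈ inj₁ x ∷ rest
      new⁻   : ∀ {v} i → inj₂ i ∈ inj₁ x ∷ rest → EndOf v i → v ∈ x ∷ xs

  open SubdividedPath

  subdividePath : ∀ {x xs} → Linked (G [_~_]) (x ∷ xs) → Unique (x ∷ xs) → SubdividedPath x xs
  subdividePath {x} {[]} [-] _ = record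
    { rest   = []
    ; linked = [-]
    ; uniq   = [] ∷ []
    ; old⁺   = λ { (here refl) → here refl }
    ; old⁻   = λ { (here refl) → here refl }
    ; new⁺   = λ { _ _ _ (there ()) }
    ; new⁻   = λ { _ (here ()) ; _ (there ()) }
    }
  subdividePath {x} {y ∷ xs} (x~y ∷ link) (x∉ ∷ un) with subdividePath link un | between? x y
  ... | p | no ¬between = record
    { rest   = inj₁ y ∷ p .rest
    ; linked = (x~y , λ xy∈ → ¬between (contained-ends xy∈)) ∷ p .linked
    ; uniq   = All.¬Any⇒All¬ _ (λ x∈ → All.lookup x∉ (p .old⁻ x∈) refl) ∷ p .uniq
    ; old⁺   = λ { (here refl) → here refl ; (there v∈) → there (p .old⁺ v∈) }
    ; old⁻   = λ { (here refl) → here refl ; (there v∈) → there (p .old⁻ v∈) }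
    ; new⁺   = λ { i ai bi here → contradiction (i , ai , bi) ¬between
                 ; i ai bi (there c) → there (p .new⁺ i ai bi c) }
    ; new⁻   = λ { i (there i∈) end → there (p .new⁻ i i∈ end) }
    }
  ... | p | yes (j , xj , yj) = record
    { rest   = inj₂ j ∷ inj₁ y ∷ p .rest
    ; linked = xj ∷ yj ∷ p .linked
    ; uniq   = All.¬Any⇒All¬ _ (λ { (there x∈) → All.lookup x∉ (p .old⁻ x∈) refl })
             ∷ All.¬Any⇒All¬ _ (λ j∈ → All.lookup x∉ (p .new⁻ j j∈ xj) refl) ∷ p .uniq
    ; old⁺   = λ { (here refl) → here refl ; (there v∈) → there (there (p .old⁺ v∈)) }
    ; old⁻   = λ { (here refl) → here refl ; (there (there v∈)) → there (p .old⁻ v∈) }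
    ; new⁺   = λ { i ai bi here → there (here (cong inj₂ (ends-injective (~⇒≢ G x~y) ai bi xj yj)))
                 ; i ai bi (there c) → there (there (p .new⁺ i ai bi c)) }
    ; new⁻   = λ { i (there (here refl)) end → ends∈ end
                 ; i (there (there i∈)) end → there (p .new⁻ i i∈ end) }
    }
    where
    ends∈ : ∀ {v} → EndOf v j → v ∈ x ∷ y ∷ xs
    ends∈ vj with ends-cover (~⇒≢ G x~y) xj yj vj
    ... | inj₁ refl = here refl
    ... | inj₂ refl = there (here refl)

  -- As every edge joins consecutive vertices of the spanning path, every subdividing vertex is
  -- inserted somewhere, so the subdivided path spans the subdivided graph and every third of its
  -- vertices can be taken.
  γ-subdividedPath≤ : ∀ {x xs} → Linked (G [_~_]) (x ∷ xs) → Unique (x ∷ xs) → (∀ v → v ∈ x ∷ xs) →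
    (∀ {a b} → G [ a ~ b ] → Consecutive a b (x ∷ xs) ⊎ Consecutive b a (x ∷ xs)) →
    ∀ {m} → order G + size F ≤ 3 * m → γ (subdivide G F) ≤ m
  γ-subdividedPath≤ {x} link un all∈ chordless {m} h
    with p ← subdividePath link un
    with linked⇒dominatingList (λ {x} {y} → subdividedAdj-sym {x} {y}) (p .linked) complete {m}
           (ℕ.≤-trans length≤ h)
    where
    complete : ∀ v → v ∈ inj₁ x ∷ p .rest
    complete (inj₁ v) = p .old⁺ (all∈ v)
    complete (inj₂ i) with chordless (proj₂ (edge-ordered i))
    ... | inj₁ c = p .new⁺ i (inj₁ refl) (inj₂ refl) c
    ... | inj₂ c = p .new⁺ i (inj₂ refl) (inj₁ refl) c

    join-injective : ∀ {x y} → join (order G) (size F) x ≡ join (order G) (size F) y → x ≡ y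
    join-injective {x} {y} eq = trans (sym (Fin.splitAt-join (order G) _ x))
      (trans (cong (splitAt (order G)) eq) (Fin.splitAt-join (order G) _ y))

    length≤ : length (inj₁ x ∷ p .rest) ≤ order G + size F
    length≤ = ℕ.≤-trans (ℕ.≤-reflexive (sym (List.length-map _ (inj₁ x ∷ p .rest))))
      (Unique⇒length≤ (Unique.map⁺ join-injective (p .uniq)))
  ... | ys , dom , len = ℕ.≤-trans (γ-subdivide≤length dom) len

-- Trees and spanning paths

Leaf : (G : Graph) → Vertex G → Vertex G → Set
Leaf G ℓ s = G [ ℓ ~ s ] × (∀ z → G [ ℓ ~ z ] → z ≡ s)

-- An initial segment of a path, with its last vertex exposed by `∷ʳ` as in the definition of
-- `Cycle`.
takeUpTo : ∀ {A : Set} {R : Rel A 0ℓ} {x y xs} → Linked R (x ∷ xs) → Unique (x ∷ xs) → y ∈ xs →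
  ∃[ zs ] Linked R (x ∷ zs ∷ʳ y) × Unique (x ∷ zs ∷ʳ y) × (∀ {v} → v ∈ x ∷ zs ∷ʳ y → v ∈ x ∷ xs)
takeUpTo (x~y ∷ _) ((x≢y ∷ _) ∷ _) (here refl) =
  [] , x~y ∷ [-] , (x≢y ∷ []) ∷ [] ∷ [] , λ { (here refl) → here refl ; (there (here refl)) → there (here refl) }
takeUpTo (x~x′ ∷ linked) (x∉ ∷ uniq) (there y∈) with takeUpTo linked uniq y∈
... | zs , linked′ , uniq′ , ⊆ =
  _ ∷ zs , x~x′ ∷ linked′ , All.tabulate (λ v∈ → All.lookup x∉ (⊆ v∈)) ∷ uniq′ ,
  λ { (here refl) → here refl ; (there v∈) → there (⊆ v∈) }

module _ (G : Graph) where

  open Graph G using (adj?) renaming (symmetric to ~-sym)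
  open DecMembership (Fin._≟_ {order G}) using (_∈?_)

  Spans : List (Vertex G) → Set
  Spans xs = Linked (G [_~_]) xs × Unique xs × (∀ v → v ∈ xs)

  -- A path is extended greedily at its head. It stops, since a list without repetitions has at most
  -- `order G` entries, and it can stop only when all neighbours of the head are on it. `Inv` is
  -- what a particular use carries along.
  saturate : (Inv : Vertex G → List (Vertex G) → Set) →
    (∀ {x xs} → Inv x xs → Unique (x ∷ xs)) →
    (∀ {x xs y} → Inv x xs → y ∉ x ∷ xs → G [ x ~ y ] → Inv y (x ∷ xs)) →
    ∀ {x xs} → Inv x xs → ∃[ y ] ∃[ ys ] Inv y ys × (∀ z → G [ y ~ z ] → z ∈ y ∷ ys)
  saturate Inv Inv⇒Unique step inv = go (order G) (ℕ.m≤m+n _ _) inv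
    where
    go : ∀ k {x xs} → order G ≤ k + length xs → Inv x xs →
         ∃[ y ] ∃[ ys ] Inv y ys × (∀ z → G [ y ~ z ] → z ∈ y ∷ ys)
    go k {x} {xs} enough inv with Fin.any? (λ z → adj? x z ×-dec ¬? (z ∈? (x ∷ xs)))
    ... | no none = x , xs , inv , closed
      where
      closed : ∀ z → G [ x ~ z ] → z ∈ x ∷ xs
      closed z x~z with z ∈? (x ∷ xs)
      ... | yes z∈ = z∈
      ... | no  z∉ = contradiction (z , x~z , z∉) none
    -- With the fuel gone, `xs` alone has at least `order G` entries, but `x ∷ xs` is longer and has
    -- no repetitions.
    go zero enough inv | yes _ = contradiction enough (ℕ.<⇒≱ (Unique⇒length≤ (Inv⇒Unique inv)))
    go (suc k) {x} {xs} enough inv | yes (z , x~z , z∉) =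
      go k (ℕ.≤-trans enough (ℕ.≤-reflexive (sym (ℕ.+-suc k (length xs))))) (step inv z∉ x~z)

  hasNeighbour : Connected G → 2 ≤ order G → ∀ v → ∃[ u ] G [ v ~ u ]
  hasNeighbour conn 2≤n v = firstStep (conn v (other v 2≤n .proj₁)) (other v 2≤n .proj₂)
    where
    other : ∀ {n} (i : Fin n) → 2 ≤ n → ∃[ j ] i ≢ j
    other zero    (s≤s (s≤s _)) = suc zero , λ ()
    other (suc i) (s≤s (s≤s _)) = zero , λ ()

    firstStep : ∀ {w} → Star (G [_~_]) v w → v ≢ w → ∃[ u ] G [ v ~ u ]
    firstStep ε         v≢v = contradiction refl v≢v
    firstStep (v~u ◅ _) _   = _ , v~u

  atMostTwo : ∀ {v a b z} → AtMostTwoNeighbours G v → a ≢ b →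
    G [ v ~ a ] → G [ v ~ b ] → G [ v ~ z ] → z ≡ a ⊎ z ≡ b
  atMostTwo (_ , _ , only) a≢b v~a v~b v~z
    with only _ (~-sym v~a) | only _ (~-sym v~b) | only _ (~-sym v~z)
  ... | inj₁ p | inj₁ q | _      = contradiction (trans p (sym q)) a≢b
  ... | inj₂ p | inj₂ q | _      = contradiction (trans p (sym q)) a≢b
  ... | inj₁ p | inj₂ q | inj₁ r = inj₁ (trans r (sym p))
  ... | inj₁ p | inj₂ q | inj₂ r = inj₂ (trans r (sym q))
  ... | inj₂ p | inj₁ q | inj₁ r = inj₂ (trans r (sym q))
  ... | inj₂ p | inj₁ q | inj₂ r = inj₁ (trans r (sym p))

  ThreeNeighbours : Vertex G → Set
  ThreeNeighbours v = ∃[ a ] ∃[ b ] ∃[ c ]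
    (G [ v ~ a ] × G [ v ~ b ] × G [ v ~ c ]) × (a ≢ b × a ≢ c × b ≢ c)

  atMostTwo⊎three : ∀ v → AtMostTwoNeighbours G v ⊎ ThreeNeighbours v
  atMostTwo⊎three v with Fin.any? (adj? v)
  ... | no none = inj₁ (v , v , λ u u~v → contradiction (u , ~-sym u~v) none)
  ... | yes (a , v~a) with Fin.any? (λ b → adj? v b ×-dec ¬? (a Fin.≟ b))
  ...   | no none = inj₁ (a , a , only)
    where
    only : ∀ u → G [ u ~ v ] → u ≡ a ⊎ u ≡ a
    only u u~v with a Fin.≟ u
    ... | yes a≡u = inj₁ (sym a≡u)
    ... | no  a≢u = contradiction (u , ~-sym u~v , a≢u) none
  ...   | yes (b , v~b , a≢b)
    with Fin.any? (λ c → adj? v c ×-dec ¬? (a Fin.≟ c) ×-dec ¬? (b Fin.≟ c))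
  ...     | yes (c , v~c , a≢c , b≢c) = inj₂ (a , b , c , (v~a , v~b , v~c) , a≢b , a≢c , b≢c)
  ...     | no none = inj₁ (a , b , only)
    where
    only : ∀ u → G [ u ~ v ] → u ≡ a ⊎ u ≡ b
    only u u~v with a Fin.≟ u | b Fin.≟ u
    ... | yes a≡u | _       = inj₁ (sym a≡u)
    ... | no  _   | yes b≡u = inj₂ (sym b≡u)
    ... | no  a≢u | no  b≢u = contradiction (u , ~-sym u~v , a≢u , b≢u) none

  module _ (acyclic : ¬ Cycle G) where

    -- A neighbour of `z` beyond `x` would close a cycle with the segment of the path that leads to
    -- it.
    neighbourOfHead : ∀ {z x y xs} → Linked (G [_~_]) (z ∷ x ∷ xs) → Unique (z ∷ x ∷ xs) →
                      G [ z ~ y ] → y ∈ z ∷ x ∷ xs → y ≡ x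
    neighbourOfHead _ _ z~z (here refl) = contradiction z~z (Graph.loopless G _)
    neighbourOfHead _ _ _ (there (here y≡x)) = y≡x
    neighbourOfHead (z~x ∷ linked) (z∉ ∷ uniq) z~y (there (there y∈)) with takeUpTo linked uniq y∈
    ... | ws , linked′ , uniq′ , ⊆ = contradiction
      (_ , _ , ws , _ , All.tabulate (λ v∈ → All.lookup z∉ (⊆ v∈)) ∷ uniq′ , z~x ∷ linked′ , ~-sym z~y)
      acyclic

    adjacent⇒consecutive : ∀ {xs a b} → Linked (G [_~_]) xs → Unique xs → a ∈ xs → b ∈ xs →
                           G [ a ~ b ] → Consecutive a b xs ⊎ Consecutive b a xs
    adjacent⇒consecutive _ _ (here refl) (here refl) a~a = contradiction a~a (Graph.loopless G _)
    adjacent⇒consecutive linked@(_ ∷ _) uniq (here refl) (there b∈) a~b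
      with refl ← neighbourOfHead linked uniq a~b (there b∈) = inj₁ here
    adjacent⇒consecutive linked@(_ ∷ _) uniq (there a∈) (here refl) a~b
      with refl ← neighbourOfHead linked uniq (~-sym a~b) (there a∈) = inj₂ here
    adjacent⇒consecutive (_ ∷ linked) (_ ∷ uniq) (there a∈) (there b∈) a~b =
      Sum.map there there (adjacent⇒consecutive linked uniq a∈ b∈ a~b)

    -- A maximal path that starts with `m` and `u` ends in a leaf: all neighbours of its end lie on
    -- it, and acyclicity leaves only the preceding vertex. The path never returns to `m`, so `P` is
    -- passed along it; later `P` says that a vertex lies in the branch of `u`.
    leafBeyond : ∀ {m u} → G [ u ~ m ] → (P : Vertex G → Set) → P u →
                 (∀ {x y} → P x → G [ x ~ y ] → y ≢ m → P y) → ∃[ ℓ ] ∃[ s ] Leaf G ℓ s × P ℓ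
    leafBeyond {m} {u} u~m P Pu P-step
      with saturate Inv (λ inv → inv .proj₂ .proj₁) step start
      where
      Inv : Vertex G → List (Vertex G) → Set
      Inv x xs = Linked (G [_~_]) (x ∷ xs) × Unique (x ∷ xs) × m ∈ xs × P x

      step : ∀ {x xs y} → Inv x xs → y ∉ x ∷ xs → G [ x ~ y ] → Inv y (x ∷ xs)
      step (linked , uniq , m∈ , Px) y∉ x~y =
        ~-sym x~y ∷ linked , All.¬Any⇒All¬ _ y∉ ∷ uniq , there m∈ ,
        P-step Px x~y λ { refl → y∉ (there m∈) }

      start : Inv u (m ∷ [])
      start = u~m ∷ [-] , (~⇒≢ G u~m ∷ []) ∷ [] ∷ [] , here refl , Pu
    ... | ℓ , s ∷ _ , (linked , uniq , _ , Pℓ) , closed =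
      ℓ , s , (Linked.head linked , λ z ℓ~z → neighbourOfHead linked uniq ℓ~z (closed z ℓ~z)) , Pℓ

    -- A path grown from a leaf has to be extended at one end only: by the degree bound, a vertex
    -- that the head has left has all its neighbours on the path. Once the head is saturated too,
    -- the path is closed under adjacency and connectedness makes it spanning.
    spanningPath : Connected G → 2 ≤ order G → (∀ v → AtMostTwoNeighbours G v) →
                   ∃[ x ] ∃[ xs ] Spans (x ∷ xs)
    spanningPath conn 2≤n two
      with v₀ ← Fin.fromℕ< (ℕ.≤-trans (s≤s z≤n) 2≤n)
      with u₀ , v₀~u₀ ← hasNeighbour conn 2≤n v₀
      with ℓ , s , (ℓ~s , only) , _ ← leafBeyond v₀~u₀ (λ _ → ⊤) tt (λ _ _ _ → tt)
      with saturate Inv (λ inv → inv .proj₂ .proj₁) step {s} {ℓ ∷ []} (start ℓ~s only)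
      where
      -- The third component keeps `xs` nonempty, so the head has a predecessor, which with the next
      -- vertex exhausts its neighbours.
      Inv : Vertex G → List (Vertex G) → Set
      Inv x xs = Linked (G [_~_]) (x ∷ xs) × Unique (x ∷ xs) ×
                 ∃ (_∈ xs) × (∀ {v z} → v ∈ xs → G [ v ~ z ] → z ∈ x ∷ xs)

      start : ∀ {ℓ s} → G [ ℓ ~ s ] → (∀ z → G [ ℓ ~ z ] → z ≡ s) → Inv s (ℓ ∷ [])
      start ℓ~s only = ~-sym ℓ~s ∷ [-] , (~⇒≢ G (~-sym ℓ~s) ∷ []) ∷ [] ∷ [] , (_ , here refl) ,
        λ { (here refl) ℓ~z → here (only _ ℓ~z) }

      step : ∀ {x xs y} → Inv x xs → y ∉ x ∷ xs → G [ x ~ y ] → Inv y (x ∷ xs)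
      step {x} {w ∷ xs} {y} (linked@(x~w ∷ _) , uniq , _ , closed) y∉ x~y =
        ~-sym x~y ∷ linked , All.¬Any⇒All¬ _ y∉ ∷ uniq , (x , here refl) , closed′
        where
        closed′ : ∀ {v z} → v ∈ x ∷ w ∷ xs → G [ v ~ z ] → z ∈ y ∷ x ∷ w ∷ xs
        closed′ (there v∈)  v~z = there (closed v∈ v~z)
        closed′ (here refl) x~z with atMostTwo (two x) (λ { refl → y∉ (there (here refl)) }) x~y x~w x~z
        ... | inj₁ refl = here refl
        ... | inj₂ refl = there (there (here refl))
    ... | x , xs , (linked , uniq , _ , closed) , closed₀ =
      x , xs , linked , uniq , λ v → reach (conn x v) (here refl)
      where
      reach : ∀ {u v} → Star (G [_~_]) u v → u ∈ x ∷ xs → v ∈ x ∷ xs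
      reach ε          u∈          = u∈
      reach (u~w ◅ ws) (here refl) = reach ws (closed₀ _ u~w)
      reach (u~w ◅ ws) (there u∈)  = reach ws (closed u∈ u~w)

    length-spanning : ∀ {xs} → Spans xs → length xs ≡ order G
    length-spanning (_ , uniq , all∈) = ℕ.≤-antisym (Unique⇒length≤ uniq) (complete⇒≤length all∈)

    lookup-adjacent⁺ : ∀ {xs} → Linked (G [_~_]) xs → (i j : Fin (length xs)) →
      suc (toℕ i) ≡ toℕ j → G [ lookup xs i ~ lookup xs j ]
    lookup-adjacent⁺ (x~y ∷ _)    zero    (suc zero) _  = x~y
    lookup-adjacent⁺ (_ ∷ linked) (suc i) (suc j)    eq = lookup-adjacent⁺ linked i j (ℕ.suc-injective eq)

    lookup-adjacent⁻ : ∀ {xs} → Linked (G [_~_]) xs → Unique xs → (i j : Fin (length xs)) →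
      G [ lookup xs i ~ lookup xs j ] → suc (toℕ i) ≡ toℕ j ⊎ suc (toℕ j) ≡ toℕ i
    lookup-adjacent⁻ {_ ∷ _} _ _ zero zero x~x = contradiction x~x (Graph.loopless G _)
    lookup-adjacent⁻ linked@(_ ∷ _) uniq zero (suc j) x~y =
      inj₁ (cong (suc ∘ toℕ) (sym (lookup-injective (AllPairs.tail uniq) {j} {zero}
        (neighbourOfHead linked uniq x~y (there (∈-lookup j))))))
    lookup-adjacent⁻ linked@(_ ∷ _) uniq (suc i) zero y~x =
      inj₂ (cong (suc ∘ toℕ) (sym (lookup-injective (AllPairs.tail uniq) {i} {zero}
        (neighbourOfHead linked uniq (~-sym y~x) (there (∈-lookup i))))))
    lookup-adjacent⁻ (_ ∷ linked) (_ ∷ uniq) (suc i) (suc j) x~y =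
      Sum.map (cong suc) (cong suc) (lookup-adjacent⁻ linked uniq i j x~y)

    spanning⇒≅Path : ∀ {xs} → Spans xs → G ≅ Path (length xs)
    spanning⇒≅Path {xs} (linked , uniq , all∈) = record
      { bijection = mk↔ₛ′ position (lookup xs) position-lookup (λ v → sym (lookup-position v))
      ; preserves = λ u v → mk⇔
          (λ u~v → lookup-adjacent⁻ linked uniq (position u) (position v)
                     (subst₂ (G [_~_]) (lookup-position u) (lookup-position v) u~v))
          (λ near → subst₂ (G [_~_]) (sym (lookup-position u)) (sym (lookup-position v))
            (Sum.[ lookup-adjacent⁺ linked (position u) (position v)
                 , (λ eq → ~-sym (lookup-adjacent⁺ linked (position v) (position u) eq)) ] near))
      }
      where
      position : Vertex G → Fin (length xs)
      position v = Any.index (all∈ v)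

      lookup-position : ∀ v → v ≡ lookup xs (position v)
      lookup-position v = lookup-index (all∈ v)

      position-lookup : ∀ i → position (lookup xs i) ≡ i
      position-lookup i = lookup-injective uniq (sym (lookup-position (lookup xs i)))

  ≅Path⇒order : ∀ {N} → G ≅ Path N → order G ≡ N
  ≅Path⇒order iso = ↔⇒≡ (_≅_.bijection iso)

  ≅Path⇒atMostTwo : ∀ {N} → G ≅ Path N → ∀ v → AtMostTwoNeighbours G v
  -- At the two ends of the path `Fin.pred` and `after` return their argument as a default; no
  -- neighbour exists on that side.
  ≅Path⇒atMostTwo {N} iso v = from (Fin.pred (to v)) , from (after (to v)) , λ u u~v →
    Sum.map (λ eq → pull (before-unique (to u) (to v) eq)) (λ eq → pull (after-unique (to u) (to v) eq))
      (Equivalence.to (_≅_.preserves iso u v) u~v)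
    where
    open Inverse (_≅_.bijection iso) using (to; from; strictlyInverseʳ)

    pull : ∀ {u i} → to u ≡ i → u ≡ from i
    pull {u} eq = trans (sym (strictlyInverseʳ u)) (cong from eq)

    before-unique : ∀ {n} (i j : Fin n) → suc (toℕ i) ≡ toℕ j → i ≡ Fin.pred j
    before-unique i (suc j) eq = Fin.toℕ-injective
      (trans (ℕ.suc-injective eq) (sym (Fin.toℕ-inject₁ j)))

    after : Fin N → Fin N
    after i with suc (toℕ i) ℕ.<? N
    ... | yes i+1<N = fromℕ< i+1<N
    ... | no  _     = i

    after-unique : ∀ i j → suc (toℕ j) ≡ toℕ i → i ≡ after j
    after-unique i j eq with suc (toℕ j) ℕ.<? N
    ... | yes j+1<N = Fin.toℕ-injective (trans (sym eq) (sym (Fin.toℕ-fromℕ< j+1<N)))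
    ... | no  j+1≮N = contradiction (subst (_< N) (sym eq) (Fin.toℕ<n i)) j+1≮N

-- Branches at a vertex with three neighbours

length-partition : ∀ {A : Set} {P : A → Set} (P? : Decidable₁ P) xs →
  length (filter P? xs) + length (filter (¬? ∘ P?) xs) ≡ length xs
length-partition P? []       = refl
length-partition P? (x ∷ xs) with P? x
... | yes _ = cong suc (length-partition P? xs)
... | no  _ = trans (ℕ.+-suc _ _) (cong suc (length-partition P? xs))

-- Subdivided pendant edges

module _ (G : Graph) (F : EdgeSet G) where

  open EdgeSet F using (EndOf)
  open Subdivision G F using (SubdividedAdj)
  open Graph G using () renaming (symmetric to ~-sym)

  -- Once its edge is subdivided, the leaf has only the new vertex as neighbour. One of these two is
  -- therefore in the list, and the contraction sends both to the leaf.
  contract-∋leaf : ∀ {f : Fin (size F) → Vertex G} {ys} → DominatingList SubdividedAdj ys →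
    ∀ {ℓ s} i → Leaf G ℓ s → EndOf ℓ i → EndOf s i → f i ≡ ℓ → ℓ ∈ map Sum.[ id , f ] ys
  contract-∋leaf {f} dom {ℓ} i (ℓ~s , only) ℓi si refl with dom (inj₁ ℓ)
  ... | inj₁ ℓ∈ = ∈-map⁺ Sum.[ id , f ] ℓ∈
  ... | inj₂ (inj₁ u , u∈ , ℓ~u , ℓu∉) with refl ← only u ℓ~u =
    contradiction (ends-contained G F i (~⇒≢ G ℓ~s) ℓi si) ℓu∉
  ... | inj₂ (inj₂ j , j∈ , ℓj) with other-end G F j ℓj
  ...   | u , u~ℓ , uj with refl ← only u (~-sym u~ℓ)
      with refl ← ends-injective G F {i = j} {i} (~⇒≢ G ℓ~s) ℓj uj ℓi si = ∈-map⁺ Sum.[ id , f ] j∈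

  -- A leaf of the list is replaced by the vertex subdividing its edge, which
  -- dominates the leaf and its support just as well.
  pendant-dominates : ∀ {f t : Fin (size F) → Vertex G} →
    (∀ i → Leaf G (f i) (t i)) → (∀ i → EndOf (f i) i) → (∀ i → EndOf (t i) i) →
    ∀ {xs} → DominatingList (G [_~_]) xs → (∀ i → f i ∈ xs) →
    ∃[ ys ] DominatingList SubdividedAdj ys × length ys ≡ length xs
  pendant-dominates {f} {t} leaf fi ti {xs} dom f∈ = map φ xs , dominates , List.length-map φ xs
    where
    f≢t : ∀ i → f i ≢ t i
    f≢t i = ~⇒≢ G (leaf i .proj₁)

    leaf? : ∀ v → Dec (∃[ i ] f i ≡ v)
    leaf? v = Fin.any? λ i → f i Fin.≟ v

    φ : Vertex G → Vertex G ⊎ Fin (size F)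
    φ v with leaf? v
    ... | yes (i , _) = inj₂ i
    ... | no  _       = inj₁ v

    φ-leaf : ∀ i → φ (f i) ≡ inj₂ i
    φ-leaf i with leaf? (f i)
    ... | no none = contradiction (i , refl) none
    ... | yes (j , fj≡fi) = cong inj₂ (ends-injective G F (f≢t i)
      (subst (λ v → EndOf v j) fj≡fi (fi j))
      (subst (λ v → EndOf v j) (leaf i .proj₂ (t j) (subst (λ v → G [ v ~ t j ]) fj≡fi (leaf j .proj₁))) (ti j))
      (fi i) (ti i))

    φ-other : ∀ {v} → (∀ i → f i ≢ v) → φ v ≡ inj₁ v
    φ-other {v} f≢v with leaf? v
    ... | yes (i , fi≡v) = contradiction fi≡v (f≢v i)
    ... | no  _          = refl

    subdividing∈ : ∀ i → inj₂ i ∈ map φ xs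
    subdividing∈ i = subst (_∈ map φ xs) (φ-leaf i) (∈-map⁺ φ (f∈ i))

    other∈ : ∀ {v} → (∀ i → f i ≢ v) → v ∈ xs → inj₁ v ∈ map φ xs
    other∈ f≢v v∈ = subst (_∈ map φ xs) (φ-other f≢v) (∈-map⁺ φ v∈)

    dominates : DominatingList SubdividedAdj (map φ xs)
    dominates (inj₂ i) = inj₁ (subdividing∈ i)
    dominates (inj₁ v) with leaf? v | Fin.any? (λ i → t i Fin.≟ v)
    ... | yes (i , refl) | _              = inj₂ (inj₂ i , subdividing∈ i , fi i)
    ... | no _           | yes (i , refl) = inj₂ (inj₂ i , subdividing∈ i , ti i)
    ... | no noleaf      | no nosupport with dom v
    ...   | inj₁ v∈ = inj₁ (other∈ (λ i fi≡v → noleaf (i , fi≡v)) v∈)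
    -- Here `v` is on no edge of `F`, so `vu` is not subdivided; and `u` is none of the leaves
    -- `f i`, as `v` would then be the support `t i`.
    ...   | inj₂ (u , u∈ , v~u) = inj₂ (inj₁ u , other∈ f≢u u∈ , v~u , uncontained)
      where
      f≢u : ∀ i → f i ≢ u
      f≢u i refl = nosupport (i , sym (leaf i .proj₂ v (~-sym v~u)))

      uncontained : ¬ EdgeSet.Contains F v u
      uncontained vu∈ with contained-ends G F vu∈
      ... | i , vi , _ with ends-cover G F (f≢t i) (fi i) (ti i) vi
      ...   | inj₁ v≡fi = noleaf (i , sym v≡fi)
      ...   | inj₂ v≡ti = nosupport (i , sym v≡ti)

module Branches (G : Graph) (connected : Connected G) (acyclic : ¬ Cycle G) (m : Vertex G) where

  open Graph G using () renaming (symmetric to ~-sym)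
  open DecMembership (Fin._≟_ {order G}) using (_∈?_)

  -- Adjacency in the graph without `m`, whose components are the branches at `m`.
  OffHub : Vertex G → Vertex G → Set
  OffHub x y = G [ x ~ y ] × x ≢ m × y ≢ m

  offHub-sym : ∀ {x y} → OffHub x y → OffHub y x
  offHub-sym (x~y , x≢m , y≢m) = ~-sym x~y , y≢m , x≢m

  firstHit : ∀ {v} → v ≢ m → Star (G [_~_]) v m → ∃[ u ] G [ m ~ u ] × Star OffHub v u
  firstHit m≢m ε = contradiction refl m≢m
  firstHit {v} v≢m (_◅_ {j = w} v~w ws) with w Fin.≟ m
  ... | yes refl = v , ~-sym v~w , ε
  ... | no  w≢m with firstHit w≢m ws
  ...   | u , m~u , path = u , m~u , (v~w , v≢m , w≢m) ◅ path

  -- Loop erasure. If `x` already occurs on the path from its neighbour `w`, acyclicity puts it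
  -- directly after `w`, and dropping `w` is enough; when `y` is `w` itself, the single edge from
  -- `x` to `w` serves instead.
  simplePath : ∀ {x y} → x ≢ m → Star OffHub x y →
    ∃[ xs ] Linked (G [_~_]) (x ∷ xs) × Unique (x ∷ xs) × All (m ≢_) (x ∷ xs) × y ∈ x ∷ xs
  simplePath x≢m ε = [] , [-] , [] ∷ [] , ≢-sym x≢m ∷ [] , here refl
  simplePath {x} x≢m ((x~w , _ , w≢m) ◅ path) with simplePath w≢m path
  ... | ws , linked , uniq , avoid , y∈ with x ∈? (_ ∷ ws)
  ...   | no x∉ = _ ∷ ws , x~w ∷ linked , All.¬Any⇒All¬ _ x∉ ∷ uniq , ≢-sym x≢m ∷ avoid , there y∈
  simplePath x≢m ((x~w , _) ◅ _) | [] , _ | yes (here refl) = contradiction x~w (Graph.loopless G _)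
  simplePath x≢m ((x~w , _ , w≢m) ◅ _) | v ∷ vs , linked , uniq , avoid , y∈ | yes x∈
    with refl ← neighbourOfHead G acyclic linked uniq (~-sym x~w) x∈ | y∈
  ... | here refl = _ ∷ [] , x~w ∷ [-] , (~⇒≢ G x~w ∷ []) ∷ [] ∷ [] ,
                    ≢-sym x≢m ∷ ≢-sym w≢m ∷ [] , there (here refl)
  ... | there y∈′ = vs , Linked.tail linked , AllPairs.tail uniq , All.tail avoid , y∈′

  -- Put `m` in front of a simple path from `u` that avoids `m` and contains `v`: the neighbour `v`
  -- of the head can only be the second vertex.
  gate-unique : ∀ {u v} → G [ m ~ u ] → G [ m ~ v ] → Star OffHub u v → u ≡ v
  gate-unique m~u m~v path with simplePath (≢-sym (~⇒≢ G m~u)) path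
  ... | xs , linked , uniq , avoid , v∈ =
    sym (neighbourOfHead G acyclic (m~u ∷ linked) (avoid ∷ uniq) m~v (there v∈))

  -- The neighbour of m through which v is reached; its fibres are the branches at m.
  gate : Vertex G → Vertex G
  gate v with v Fin.≟ m
  -- This default places the hub outside every branch, since `m` is not its own neighbour.
  ... | yes _   = m
  ... | no  v≢m = firstHit v≢m (connected v m) .proj₁

  gate-m : gate m ≡ m
  gate-m with m Fin.≟ m
  ... | yes _   = refl
  ... | no  m≢m = contradiction refl m≢m

  gate-path : ∀ {v} → v ≢ m → G [ m ~ gate v ] × Star OffHub v (gate v)
  gate-path {v} v≢m with v Fin.≟ m
  ... | yes v≡m = contradiction v≡m v≢m
  ... | no  v≢m = firstHit v≢m (connected v m) .proj₂

  gate-neighbour : ∀ {u} → G [ m ~ u ] → gate u ≡ u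
  gate-neighbour m~u with gate-path (≢-sym (~⇒≢ G m~u))
  ... | m~g , path = sym (gate-unique m~u m~g path)

  gate-step : ∀ {v w} → G [ v ~ w ] → v ≢ m → w ≢ m → gate v ≡ gate w
  gate-step v~w v≢m w≢m with gate-path v≢m | gate-path w≢m
  ... | m~gv , pathv | m~gw , pathw = gate-unique m~gv m~gw
    (reverse offHub-sym pathv ◅◅ (v~w , v≢m , w≢m) ◅ pathw)

  -- A minimum dominating set as a list; by `γ≤length` the inequality is an equality.
  OptimalList : List (Vertex G) → Set
  OptimalList xs = DominatingList (G [_~_]) xs × length xs ≤ γ G

  -- Such a `z` dominates `m` whatever is done inside the branch of `u`.
  OutsideNeighbour : Vertex G → List (Vertex G) → Set
  OutsideNeighbour u xs = ∃[ z ] z ∈ xs × z ≢ u × G [ m ~ z ]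

  module _ {u : Vertex G} (m~u : G [ m ~ u ]) where

    outside-m : gate m ≢ u
    outside-m gm≡u = ~⇒≢ G m~u (trans (sym gate-m) gm≡u)

    -- Adjacent vertices other than `m` have the same gate, so `um` is the only edge that leaves the
    -- branch of `u`.
    cut : ∀ {v w} → gate v ≡ u → gate w ≢ u → G [ v ~ w ] → v ≡ u × w ≡ m
    cut {v} {w} gv gw v~w = at (w Fin.≟ m)
      where
      at : Dec (w ≡ m) → v ≡ u × w ≡ m
      at (yes refl) = trans (sym (gate-neighbour (~-sym v~w))) gv , refl
      at (no  w≢m)  = contradiction
        (trans (sym (gate-step v~w (λ { refl → outside-m gv }) w≢m)) gv) gw

    inside? : ∀ v → Dec (gate v ≡ u)
    inside? v = gate v Fin.≟ u

    hybrid : List (Vertex G) → List (Vertex G) → List (Vertex G)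
    hybrid xs ys = filter inside? xs ++ filter (¬? ∘ inside?) ys

    hybrid-inside : ∀ {xs} ys {v} → v ∈ xs → gate v ≡ u → v ∈ hybrid xs ys
    hybrid-inside _ v∈ gv = ∈-++⁺ˡ (∈-filter⁺ inside? v∈ gv)

    hybrid-outside : ∀ xs {ys v} → v ∈ ys → gate v ≢ u → v ∈ hybrid xs ys
    hybrid-outside xs v∈ gv = ∈-++⁺ʳ (filter inside? xs) (∈-filter⁺ (¬? ∘ inside?) v∈ gv)

    hybrid-∌m : ∀ {xs ys} → m ∉ xs → m ∉ ys → m ∉ hybrid xs ys
    hybrid-∌m {xs} m∉xs m∉ys m∈ with ∈-++⁻ (filter inside? xs) m∈
    ... | inj₁ p = m∉xs (∈-filter⁻ inside? p .proj₁)
    ... | inj₂ p = m∉ys (∈-filter⁻ (¬? ∘ inside?) p .proj₁)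

    -- By `cut`, a splice can lose domination only across the edge `um`. With `hubs` or `gates` an
    -- end of that edge is in both splices; with `outsides` the vertex `u` never relied on `m`, and
    -- `m` keeps a dominator outside the branch. Each case is symmetric, so both splices dominate.
    data Compatible (xs ys : List (Vertex G)) : Set where
      hubs     : m ∈ xs → m ∈ ys → Compatible xs ys
      gates    : u ∈ xs → u ∈ ys → Compatible xs ys
      outsides : m ∉ xs → m ∉ ys → OutsideNeighbour u xs → OutsideNeighbour u ys → Compatible xs ys

    compatible-sym : ∀ {xs ys} → Compatible xs ys → Compatible ys xs
    compatible-sym (hubs p q)         = hubs q p
    compatible-sym (gates p q)        = gates q p
    compatible-sym (outsides p q r s) = outsides q p s r

    hybrid-dominates : ∀ {xs ys} → DominatingList (G [_~_]) xs → DominatingList (G [_~_]) ys →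
      Compatible xs ys → DominatingList (G [_~_]) (hybrid xs ys)
    hybrid-dominates {xs} {ys} domx domy compat v with inside? v
    ... | yes gv with domx v
    ...   | inj₁ v∈ = inj₁ (hybrid-inside ys v∈ gv)
    ...   | inj₂ (w , w∈ , v~w) with inside? w
    ...     | yes gw = inj₂ (w , hybrid-inside ys w∈ gw , v~w)
    ...     | no  gw with cut gv gw v~w | compat
    ...       | refl , refl | hubs _ m∈          = inj₂ (m , hybrid-outside xs m∈ gw , v~w)
    ...       | refl , refl | gates u∈ _         = inj₁ (hybrid-inside ys u∈ gv)
    ...       | refl , refl | outsides m∉ _ _ _  = contradiction w∈ m∉
    hybrid-dominates {xs} {ys} domx domy compat v | no gv with domy v
    ...   | inj₁ v∈ = inj₁ (hybrid-outside xs v∈ gv)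
    ...   | inj₂ (w , w∈ , v~w) with inside? w
    ...     | no  gw = inj₂ (w , hybrid-outside xs w∈ gw , v~w)
    ...     | yes gw with cut gw gv (~-sym v~w) | compat
    ...       | refl , refl | hubs _ m∈  = inj₁ (hybrid-outside xs m∈ gv)
    ...       | refl , refl | gates u∈ _ = inj₂ (u , hybrid-inside ys u∈ gw , v~w)
    ...       | refl , refl | outsides _ _ _ (z , z∈ , z≢u , m~z) =
      inj₂ (z , hybrid-outside xs z∈ (λ gz → z≢u (trans (sym (gate-neighbour m~z)) gz)) , m~z)

    -- The two hybrids of xs and ys have total length at most 2γ, and neither is
    -- shorter than γ.
    hybrid-optimal : ∀ {xs ys} → OptimalList xs → OptimalList ys → Compatible xs ys →
                     OptimalList (hybrid xs ys)
    hybrid-optimal {xs} {ys} (domx , lenx) (domy , leny) compat =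
      hybrid-dominates domx domy compat ,
      ℕ.+-cancelʳ-≤ (γ G) _ _ (begin
        length (hybrid xs ys) + γ G                       ≤⟨ ℕ.+-monoʳ-≤ _ (γ≤length G (hybrid-dominates domy domx (compatible-sym compat))) ⟩
        length (hybrid xs ys) + length (hybrid ys xs)     ≡⟨ cong₂ _+_ (List.length-++ (filter inside? xs)) (List.length-++ (filter inside? ys)) ⟩
        (inx + outy) + (iny + outx)                       ≡⟨ solve 4 (λ a b c d → (a :+ b) :+ (c :+ d) := (a :+ d) :+ (c :+ b)) refl inx outy iny outx ⟩
        (inx + outx) + (iny + outy)                       ≡⟨ cong₂ _+_ (length-partition inside? xs) (length-partition inside? ys) ⟩
        length xs + length ys                             ≤⟨ ℕ.+-mono-≤ lenx leny ⟩
        γ G + γ G                                         ∎)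
      where
      open ℕ.≤-Reasoning
      open +-*-Solver
      inx  = length (filter inside? xs)
      outx = length (filter (¬? ∘ inside?) xs)
      iny  = length (filter inside? ys)
      outy = length (filter (¬? ∘ inside?) ys)

  -- If the support is `m`, then the leaf is `u` itself; this pendant case is treated apart below.
  record Tip (u : Vertex G) : Set where
    field
      ℓ s  : Vertex G
      leaf : Leaf G ℓ s
      gateℓ : gate ℓ ≡ u

  open Tip

  findTip : ∀ {u} → G [ m ~ u ] → Tip u
  findTip {u} m~u with leafBeyond G acyclic (~-sym m~u) (λ v → gate v ≡ u) (gate-neighbour m~u)
      (λ gx x~y y≢m → trans (sym (gate-step x~y (λ { refl → outside-m m~u gx }) y≢m)) gx)
  ... | ℓ , s , leaf , gateℓ = record { ℓ = ℓ ; s = s ; leaf = leaf ; gateℓ = gateℓ }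

  -- Minimum dominating lists when no two edges raise the domination number

  module _ (γ-keep : ∀ F → size F ≡ 2 → γ (subdivide G F) ≤ γ G) where

    abstract
      -- As `F` does not raise γ, contracting a minimum dominating list of the subdivided graph
      -- gives a minimum one of `G`, whichever ends are chosen.
      contract-optimal : ∀ F → size F ≡ 2 → ∃[ ys ] DominatingList (Subdivision.SubdividedAdj G F) ys ×
        (∀ {f : Fin (size F) → Vertex G} → (∀ i → EdgeSet.EndOf F (f i) i) →
          OptimalList (map Sum.[ id , f ] ys))
      contract-optimal F two with γ-subdivide-list G F
      ... | ys , dom , len = ys , dom , λ ends → contract-dominates G F ends dom ,
        ℕ.≤-trans (ℕ.≤-reflexive (trans (List.length-map _ ys) len)) (γ-keep F two)

    module _ {u : Vertex G} (m~u : G [ m ~ u ]) (t : Tip u) where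

      ℓ≢m : t .ℓ ≢ m
      ℓ≢m refl = outside-m m~u (t .gateℓ)

      ℓ≢tip : ∀ {v} (t′ : Tip v) → u ≢ v → t .ℓ ≢ t′ .ℓ
      ℓ≢tip t′ u≢v ℓ≡ℓ′ = u≢v (trans (sym (t .gateℓ)) (trans (cong gate ℓ≡ℓ′) (t′ .gateℓ)))

      support-inside : t .s ≢ m → gate (t .s) ≡ u
      support-inside s≢m = trans (sym (gate-step (t .leaf .proj₁) ℓ≢m s≢m)) (t .gateℓ)

    ℓ≢support : ∀ {u v} (m~u : G [ m ~ u ]) (m~v : G [ m ~ v ]) (t : Tip u) (t′ : Tip v) →
                u ≢ v → t .ℓ ≢ t′ .s
    ℓ≢support m~u m~v t t′ u≢v ℓ≡s = u≢v (trans (sym (t .gateℓ))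
      (trans (cong gate ℓ≡s) (support-inside m~v t′ (λ s≡m → ℓ≢m m~u t (trans ℓ≡s s≡m)))))

    leafEdge : ∀ {u} → Tip u → Vertex G × Vertex G
    leafEdge t = t .ℓ , t .s

    leafEdges-distinguished : ∀ {u v} (m~u : G [ m ~ u ]) (m~v : G [ m ~ v ]) (t : Tip u) (t′ : Tip v) →
      u ≢ v → Distinguished G (leafEdge t) (leafEdge t′)
    leafEdges-distinguished m~u m~v t t′ u≢v =
      t .ℓ , inj₁ refl , Sum.[ ℓ≢tip m~u t t′ u≢v , ℓ≢support m~u m~v t t′ u≢v ]

    -- Both leaf edges are subdivided and then contracted into their leaves.
    twoLeaves : ∀ {u v} (m~u : G [ m ~ u ]) (m~v : G [ m ~ v ]) (t : Tip u) (t′ : Tip v) → u ≢ v →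
                ∃[ xs ] OptimalList xs × t .ℓ ∈ xs × t′ .ℓ ∈ xs
    twoLeaves m~u m~v t t′ u≢v = _ , optimal ends ,
      contract-∋leaf G F {f} dom zero       (t  .leaf) (ends zero)       (far zero)       refl ,
      contract-∋leaf G F {f} dom (suc zero) (t′ .leaf) (ends (suc zero)) (far (suc zero)) refl
      where
      F = edgeSet G (leafEdge t ∷ leafEdge t′ ∷ []) (t .leaf .proj₁ ∷ t′ .leaf .proj₁ ∷ [])
            ((leafEdges-distinguished m~u m~v t t′ u≢v ∷ []) ∷ [] ∷ [])

      dom     = contract-optimal F refl .proj₂ .proj₁
      optimal = contract-optimal F refl .proj₂ .proj₂

      f : Fin 2 → Vertex G
      f zero    = t .ℓ
      f (suc _) = t′ .ℓ

      ends : ∀ i → EdgeSet.EndOf F (f i) i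
      ends zero       = endsAt-orient⁺ G (leafEdge t) (inj₁ refl)
      ends (suc zero) = endsAt-orient⁺ G (leafEdge t′) (inj₁ refl)

      far : ∀ i → EdgeSet.EndOf F (lookup (t .s ∷ t′ .s ∷ []) i) i
      far zero       = endsAt-orient⁺ G (leafEdge t) (inj₂ refl)
      far (suc zero) = endsAt-orient⁺ G (leafEdge t′) (inj₂ refl)

    -- The leaf edge and `mu`, distinct as the leaf is not `u`, are subdivided and contracted into
    -- the leaf and into `m`. If `m` is then absent, neither `m` nor the vertex on `mu` was in the
    -- original list: that vertex is dominated by `u`, and `m` by a neighbour other than `u`.
    gateAndLeaf : ∀ {u} (m~u : G [ m ~ u ]) (t : Tip u) → t .ℓ ≢ u →
      ∃[ xs ] OptimalList xs × t .ℓ ∈ xs × (m ∈ xs ⊎ (m ∉ xs × u ∈ xs × OutsideNeighbour u xs))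
    gateAndLeaf {u} m~u t ℓ≢u = xs , optimal ends , ℓ∈ , hub (m ∈? xs)
      where
      F = edgeSet G (leafEdge t ∷ (m , u) ∷ []) (t .leaf .proj₁ ∷ m~u ∷ [])
            (((t .ℓ , inj₁ refl , Sum.[ ℓ≢m m~u t , ℓ≢u ]) ∷ []) ∷ [] ∷ [])

      open Subdivision G F using (SubdividedAdj)

      ys      = contract-optimal F refl .proj₁
      dom     = contract-optimal F refl .proj₂ .proj₁
      optimal = contract-optimal F refl .proj₂ .proj₂

      f : Fin 2 → Vertex G
      f zero    = t .ℓ
      f (suc _) = m

      ends : ∀ i → EdgeSet.EndOf F (f i) i
      ends zero       = endsAt-orient⁺ G (leafEdge t) (inj₁ refl)
      ends (suc zero) = endsAt-orient⁺ G (m , u) (inj₁ refl)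

      uEnd : EdgeSet.EndOf F u (suc zero)
      uEnd = endsAt-orient⁺ G (m , u) (inj₂ refl)

      xs : List (Vertex G)
      xs = map Sum.[ id , f ] ys

      ℓ∈ : t .ℓ ∈ xs
      ℓ∈ = contract-∋leaf G F {f} dom zero (t .leaf) (ends zero)
             (endsAt-orient⁺ G (leafEdge t) (inj₂ refl)) refl

      s≢m : t .s ≢ m
      s≢m refl = ℓ≢u (trans (sym (gate-neighbour (~-sym (t .leaf .proj₁)))) (t .gateℓ))

      u∈ : m ∉ xs → u ∈ xs
      u∈ m∉ with dom (inj₂ (suc zero))
      ... | inj₁ w∈ = contradiction (∈-map⁺ Sum.[ id , f ] w∈) m∉
      ... | inj₂ (inj₁ v , v∈ , end) with endsAt-orient⁻ G (m , u) end
      ...   | inj₁ refl = contradiction (∈-map⁺ Sum.[ id , f ] v∈) m∉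
      ...   | inj₂ refl = ∈-map⁺ Sum.[ id , f ] v∈

      outsider : m ∉ xs → OutsideNeighbour u xs
      outsider m∉ with dom (inj₁ m)
      ... | inj₁ m∈ = contradiction (∈-map⁺ Sum.[ id , f ] m∈) m∉
      ... | inj₂ (inj₁ v , v∈ , m~v , mv∉F) = v , ∈-map⁺ Sum.[ id , f ] v∈ ,
        (λ { refl → mv∉F (ends-contained G F (suc zero) (~⇒≢ G m~u) (ends (suc zero)) uEnd) }) , m~v
      ... | inj₂ (inj₂ (suc zero) , w∈ , _) = contradiction (∈-map⁺ Sum.[ id , f ] w∈) m∉
      -- The vertex on the leaf edge is adjacent only to the leaf and its support, and neither is
      -- `m`.
      ... | inj₂ (inj₂ zero , _ , end) with endsAt-orient⁻ G (leafEdge t) end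
      ...   | inj₁ m≡ℓ = contradiction (sym m≡ℓ) (ℓ≢m m~u t)
      ...   | inj₂ m≡s = contradiction (sym m≡s) s≢m

      hub : Dec (m ∈ xs) → m ∈ xs ⊎ (m ∉ xs × u ∈ xs × OutsideNeighbour u xs)
      hub (yes m∈) = inj₁ m∈
      hub (no  m∉) = inj₂ (m∉ , u∈ m∉ , outsider m∉)

    outsideNeighbour : ∀ {u xs} → OptimalList xs → m ∉ xs → u ∉ xs → OutsideNeighbour u xs
    outsideNeighbour (dom , _) m∉ u∉ with dom m
    ... | inj₁ m∈             = contradiction m∈ m∉
    ... | inj₂ (z , z∈ , m~z) = z , z∈ , (λ { refl → u∉ z∈ }) , m~z

    -- If a minimum list had both the leaf and its support `m`, the leaf could be deleted: it is
    -- dominated by `m`, and the only vertex it dominates besides itself is `m`, which stays.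
    pendant-hub : ∀ {ℓ xs} → Leaf G ℓ m → OptimalList xs → ℓ ∈ xs → m ∉ xs
    pendant-hub {ℓ} {xs} (ℓ~m , only) (dom , len) ℓ∈ m∈ = ℕ.<⇒≱
      (ℕ.<-≤-trans (List.filter-notAll other? xs (Any.map (λ { refl ℓ≢ℓ → ℓ≢ℓ refl }) ℓ∈)) len)
      (γ≤length G dominates)
      where
      other? : ∀ v → Dec (v ≢ ℓ)
      other? v = ¬? (v Fin.≟ ℓ)

      m∈′ : m ∈ filter other? xs
      m∈′ = ∈-filter⁺ other? m∈ (≢-sym (~⇒≢ G ℓ~m))

      dominates : DominatingList (G [_~_]) (filter other? xs)
      dominates v with v Fin.≟ ℓ
      ... | yes refl = inj₂ (m , m∈′ , ℓ~m)
      ... | no  v≢ℓ with dom v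
      ...   | inj₁ v∈ = inj₁ (∈-filter⁺ other? v∈ v≢ℓ)
      ...   | inj₂ (w , w∈ , v~w) with w Fin.≟ ℓ
      ...     | no  w≢ℓ = inj₂ (w , ∈-filter⁺ other? w∈ w≢ℓ , v~w)
      ...     | yes refl with refl ← only v (~-sym v~w) = inj₁ m∈′

    module _ {a b c} (m~a : G [ m ~ a ]) (m~b : G [ m ~ b ]) (m~c : G [ m ~ c ])
             (a≢b : a ≢ b) (a≢c : a ≢ c) (b≢c : b ≢ c) (tₐ : Tip a) (t_b : Tip b) (t_c : Tip c) where

      AllThree : Set
      AllThree = ∃[ xs ] OptimalList xs × tₐ .ℓ ∈ xs × t_b .ℓ ∈ xs × t_c .ℓ ∈ xs

      private
        elsewhere : ∀ {u v} (t : Tip u) → u ≢ v → gate (t .ℓ) ≢ v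
        elsewhere t u≢v gℓ = u≢v (trans (sym (t .gateℓ)) gℓ)

      joinAcross-a : ∀ {xs ys} → OptimalList xs → OptimalList ys → Compatible m~a xs ys →
        tₐ .ℓ ∈ xs → t_b .ℓ ∈ ys → t_c .ℓ ∈ ys → AllThree
      joinAcross-a {xs} {ys} ox oy compat a∈ b∈ c∈ = hybrid m~a xs ys , hybrid-optimal m~a ox oy compat ,
        hybrid-inside m~a ys a∈ (tₐ .gateℓ) ,
        hybrid-outside m~a xs b∈ (elsewhere t_b (≢-sym a≢b)) ,
        hybrid-outside m~a xs c∈ (elsewhere t_c (≢-sym a≢c))

      joinAcross-b : ∀ {xs ys} → OptimalList xs → OptimalList ys → Compatible m~b xs ys →
        tₐ .ℓ ∈ ys → t_b .ℓ ∈ xs → t_c .ℓ ∈ ys → AllThree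
      joinAcross-b {xs} {ys} ox oy compat a∈ b∈ c∈ = hybrid m~b xs ys , hybrid-optimal m~b ox oy compat ,
        hybrid-outside m~b xs a∈ (elsewhere tₐ a≢b) ,
        hybrid-inside m~b ys b∈ (t_b .gateℓ) ,
        hybrid-outside m~b xs c∈ (elsewhere t_c (≢-sym b≢c))

      -- Both lists with the leaf `a` avoid its support `m`, and `a` dominates `m` from outside the
      -- branch of `b`; so they can be spliced across that branch.
      allThree-pendant : tₐ .ℓ ≡ a → AllThree
      allThree-pendant ℓ≡a
        with twoLeaves m~a m~b tₐ t_b a≢b | twoLeaves m~a m~c tₐ t_c a≢c
      ... | xs , ox , a∈x , b∈x | ys , oy , a∈y , c∈y =
        joinAcross-b ox oy (outsides (pendant-hub leaf-m ox a∈x) (pendant-hub leaf-m oy a∈y)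
          (a , subst (_∈ xs) ℓ≡a a∈x , a≢b , m~a) (a , subst (_∈ ys) ℓ≡a a∈y , a≢b , m~a)) a∈y b∈x c∈y
        where
        leaf-m : Leaf G (tₐ .ℓ) m
        leaf-m = ℓ~m , λ z ℓ~z → trans (tₐ .leaf .proj₂ z ℓ~z) (sym (tₐ .leaf .proj₂ m ℓ~m))
          where ℓ~m = subst (λ v → G [ v ~ m ]) (sym ℓ≡a) (~-sym m~a)

      -- If no splice across a's branch works at once, then m lies in the list for b and c
      -- but not in those for a and b or a and c.  Splicing xs into the latter two
      -- puts a, a neighbour of m outside b's branch, into both.
      allThree-gate : ∀ {xs} → OptimalList xs → tₐ .ℓ ∈ xs → m ∉ xs → a ∈ xs →
                      OutsideNeighbour a xs → AllThree
      allThree-gate {xs} ox ℓ∈ m∉ a∈ out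
        with ys , oy , b∈y , c∈y ← twoLeaves m~b m~c t_b t_c b≢c
        with a ∈? ys | m ∈? ys
      ... | yes a∈y | _      = joinAcross-a ox oy (gates a∈ a∈y) ℓ∈ b∈y c∈y
      ... | no a∉y  | no m∉y =
        joinAcross-a ox oy (outsides m∉ m∉y out (outsideNeighbour oy m∉y a∉y)) ℓ∈ b∈y c∈y
      ... | no _    | yes m∈y
        with zs , oz , a∈z , b∈z ← twoLeaves m~a m~b tₐ t_b a≢b
           | ws , ow , a∈w , c∈w ← twoLeaves m~a m~c tₐ t_c a≢c
        with m ∈? zs | m ∈? ws
      ...   | yes m∈z | _       = joinAcross-a oz oy (hubs m∈z m∈y) a∈z b∈y c∈y
      ...   | no _    | yes m∈w = joinAcross-a ow oy (hubs m∈w m∈y) a∈w b∈y c∈y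
      ...   | no m∉z  | no m∉w  =
        joinAcross-b (optimal oz m∉z) (optimal ow m∉w)
          (outsides (hybrid-∌m m~a m∉ m∉z) (hybrid-∌m m~a m∉ m∉w) (a , gate∈ zs , a≢b , m~a)
                    (a , gate∈ ws , a≢b , m~a))
          (hybrid-inside m~a ws ℓ∈ (tₐ .gateℓ))
          (hybrid-outside m~a xs b∈z (elsewhere t_b (≢-sym a≢b)))
          (hybrid-outside m~a xs c∈w (elsewhere t_c (≢-sym a≢c)))
        where
        gate∈ : ∀ vs → a ∈ hybrid m~a xs vs
        gate∈ vs = hybrid-inside m~a vs a∈ (gate-neighbour m~a)

        -- The list `xs` is compatible with every optimal list avoiding `m`: it has `a` for `gates`
        -- and a further neighbour of `m` for `outsides`.
        optimal : ∀ {vs} → OptimalList vs → m ∉ vs → OptimalList (hybrid m~a xs vs)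
        optimal {vs} ov m∉v with a ∈? vs
        ... | yes a∈v = hybrid-optimal m~a ox ov (gates a∈ a∈v)
        ... | no  a∉v = hybrid-optimal m~a ox ov (outsides m∉ m∉v out (outsideNeighbour ov m∉v a∉v))

      hub⊎allThree : (∃[ xs ] OptimalList xs × tₐ .ℓ ∈ xs × m ∈ xs) ⊎ AllThree
      hub⊎allThree with tₐ .ℓ Fin.≟ a
      ... | yes ℓ≡a = inj₂ (allThree-pendant ℓ≡a)
      ... | no  ℓ≢a with gateAndLeaf m~a tₐ ℓ≢a
      ...   | xs , ox , ℓ∈ , inj₁ m∈            = inj₁ (xs , ox , ℓ∈ , m∈)
      ...   | xs , ox , ℓ∈ , inj₂ (m∉ , a∈ , out) = inj₂ (allThree-gate ox ℓ∈ m∉ a∈ out)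

    -- Unless one of the branches settles the claim, each leaf lies with `m` in a minimum list.
    -- Sharing `m`, the three lists can be spliced across the branches of `b` and `a` in turn.
    allThree : ∀ {a b c} (m~a : G [ m ~ a ]) (m~b : G [ m ~ b ]) (m~c : G [ m ~ c ])
      (a≢b : a ≢ b) (a≢c : a ≢ c) (b≢c : b ≢ c) (tₐ : Tip a) (t_b : Tip b) (t_c : Tip c) →
      AllThree m~a m~b m~c a≢b a≢c b≢c tₐ t_b t_c
    allThree m~a m~b m~c a≢b a≢c b≢c tₐ t_b t_c
      with hub⊎allThree m~a m~b m~c a≢b a≢c b≢c tₐ t_b t_c
         | hub⊎allThree m~b m~a m~c (≢-sym a≢b) b≢c a≢c t_b tₐ t_c
         | hub⊎allThree m~c m~a m~b (≢-sym a≢c) (≢-sym b≢c) a≢b t_c tₐ t_b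
    ... | inj₂ all | _ | _ = all
    ... | inj₁ _ | inj₂ (xs , ox , b∈ , a∈ , c∈) | _ = xs , ox , a∈ , b∈ , c∈
    ... | inj₁ _ | inj₁ _ | inj₂ (xs , ox , c∈ , a∈ , b∈) = xs , ox , a∈ , b∈ , c∈
    ... | inj₁ (xs , ox , a∈ , m∈x) | inj₁ (ys , oy , b∈ , m∈y) | inj₁ (zs , oz , c∈ , m∈z) =
      joinAcross-a m~a m~b m~c a≢b a≢c b≢c tₐ t_b t_c ox
        (hybrid-optimal m~b oy oz (hubs m∈y m∈z))
        (hubs m∈x (hybrid-outside m~b ys m∈z (outside-m m~b))) a∈
        (hybrid-inside m~b zs b∈ (t_b .gateℓ))
        (hybrid-outside m~b ys c∈ (λ gℓ → b≢c (trans (sym gℓ) (t_c .gateℓ))))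

    -- By `pendant-dominates`, a minimum list with leaves from three branches shows that subdividing
    -- their three edges does not raise γ.
    increases⇒no-three : (∀ F → size F ≡ 3 → γ G < γ (subdivide G F)) → ¬ ThreeNeighbours G m
    increases⇒no-three raise (a , b , c , (m~a , m~b , m~c) , a≢b , a≢c , b≢c)
      with tₐ ← findTip m~a | t_b ← findTip m~b | t_c ← findTip m~c
      with xs , (dom , len) , a∈ , b∈ , c∈ ← allThree m~a m~b m~c a≢b a≢c b≢c tₐ t_b t_c
      = ℕ.<⇒≱ (raise F refl) (ℕ.≤-trans (γ-subdivide≤length G F (dominated .proj₂ .proj₁))
          (ℕ.≤-trans (ℕ.≤-reflexive (dominated .proj₂ .proj₂)) len))
      where
      es = leafEdge tₐ ∷ leafEdge t_b ∷ leafEdge t_c ∷ []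

      F = edgeSet G es (tₐ .leaf .proj₁ ∷ t_b .leaf .proj₁ ∷ t_c .leaf .proj₁ ∷ [])
            ((leafEdges-distinguished m~a m~b tₐ t_b a≢b ∷ leafEdges-distinguished m~a m~c tₐ t_c a≢c ∷ [])
            ∷ (leafEdges-distinguished m~b m~c t_b t_c b≢c ∷ []) ∷ [] ∷ [])

      near far : Fin 3 → Vertex G
      near i = lookup es i .proj₁
      far  i = lookup es i .proj₂

      leaves : ∀ i → Leaf G (near i) (far i)
      leaves zero             = tₐ .leaf
      leaves (suc zero)       = t_b .leaf
      leaves (suc (suc zero)) = t_c .leaf

      ends : ∀ {v} i → v EndsAt lookup es i → EdgeSet.EndOf F v i
      ends zero             = endsAt-orient⁺ G _
      ends (suc zero)       = endsAt-orient⁺ G _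
      ends (suc (suc zero)) = endsAt-orient⁺ G _

      near∈ : ∀ i → near i ∈ xs
      near∈ zero             = a∈
      near∈ (suc zero)       = b∈
      near∈ (suc (suc zero)) = c∈

      dominated = pendant-dominates G F leaves (λ i → ends i (inj₁ refl)) (λ i → ends i (inj₂ refl)) dom near∈

-- Paths

-- The edges are distinct because the first end of each lies on no later edge of the path.
firstEdges : ∀ G {xs} → Linked (G [_~_]) xs → Unique xs → ∀ j → j ≤ 3 → j < length xs →
             Σ (EdgeSet G) λ F → size F ≡ j
firstEdges G _ _ 0 _ _ = edgeSet G [] [] [] , refl
firstEdges G (x~y ∷ _) _ 1 _ _ = edgeSet G _ (x~y ∷ []) ([] ∷ []) , refl
firstEdges G (x~y ∷ y~z ∷ _) ((x≢y ∷ x≢z ∷ _) ∷ _) 2 _ _ =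
  edgeSet G _ (x~y ∷ y~z ∷ [])
    (((_ , inj₁ refl , Sum.[ x≢y , x≢z ]) ∷ []) ∷ [] ∷ []) , refl
firstEdges G (x~y ∷ y~z ∷ z~w ∷ _) ((x≢y ∷ x≢z ∷ x≢w ∷ _) ∷ (y≢z ∷ y≢w ∷ _) ∷ _) 3 _ _ =
  edgeSet G _ (x~y ∷ y~z ∷ z~w ∷ [])
    (((_ , inj₁ refl , Sum.[ x≢y , x≢z ]) ∷ (_ , inj₁ refl , Sum.[ x≢z , x≢w ]) ∷ [])
    ∷ ((_ , inj₁ refl , Sum.[ y≢z , y≢w ]) ∷ []) ∷ [] ∷ []) , refl
firstEdges G [-] _ (suc _) _ (s≤s ())
firstEdges G (_ ∷ [-]) _ (suc (suc _)) _ (s≤s (s≤s ()))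
firstEdges G (_ ∷ _ ∷ [-]) _ (suc (suc (suc _))) _ (s≤s (s≤s (s≤s ())))
firstEdges G _ _ (suc (suc (suc (suc _)))) (s≤s (s≤s (s≤s ()))) _

module PathLike (T : Graph) (tree : IsTree T) (order≥3 : 3 ≤ order T)
                (two : ∀ v → AtMostTwoNeighbours T v) where

  open IsTree tree

  abstract
    spanning : ∃[ x ] ∃[ xs ] Spans T (x ∷ xs)
    spanning = spanningPath T acyclic connected (ℕ.≤-trans (ℕ.n≤1+n 2) order≥3) two

  vertices : List (Vertex T)
  vertices = spanning .proj₁ ∷ spanning .proj₂ .proj₁

  spans : Spans T vertices
  spans = spanning .proj₂ .proj₂

  length-vertices : length vertices ≡ order T
  length-vertices = length-spanning T acyclic spans

  edgesOfSize : ∀ j → j ≤ 3 → j < order T → Σ (EdgeSet T) λ F → size F ≡ j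
  edgesOfSize j j≤3 j<n = firstEdges T (spans .proj₁) (spans .proj₂ .proj₁) j j≤3
    (ℕ.≤-trans j<n (ℕ.≤-reflexive (sym length-vertices)))

  -- Together with `order≤3*γ` this is γ = ⌈n/3⌉, with the ceiling expressed by multiples of 3; the
  -- next two lemmas do the same for subdivisions.
  γ≤ : ∀ {m} → order T ≤ 3 * m → γ T ≤ m
  γ≤ {m} n≤3m with linked⇒dominatingList (Graph.symmetric T) (spans .proj₁) (spans .proj₂ .proj₂) {m}
                 (ℕ.≤-trans (ℕ.≤-reflexive length-vertices) n≤3m)
  ... | _ , dom , len = ℕ.≤-trans (γ≤length T dom) len

  order≤3*γ : order T ≤ 3 * γ T
  order≤3*γ with γ-list T
  ... | xs , dom , len = ℕ.≤-trans
    (order≤3*length id id two dom)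
    (ℕ.≤-reflexive (cong (3 *_) len))

  γ-subdivide≤ : ∀ F {m} → order T + size F ≤ 3 * m → γ (subdivide T F) ≤ m
  γ-subdivide≤ F {m} = γ-subdividedPath≤ T F (spans .proj₁) (spans .proj₂ .proj₁) (spans .proj₂ .proj₂)
    (λ {a} {b} → adjacent⇒consecutive T acyclic (spans .proj₁) (spans .proj₂ .proj₁)
                   (spans .proj₂ .proj₂ a) (spans .proj₂ .proj₂ b)) {m}

  γ-subdivide> : ∀ F {m} → 3 * m < order T + size F → m < γ (subdivide T F)
  γ-subdivide> F {m} 3m< = ℕ.*-cancelˡ-< 3 m _ (ℕ.<-≤-trans 3m< (order≤3*γ-subdivide T F two))

  ≅Path-order : T ≅ Path (order T)
  ≅Path-order = subst (λ N → T ≅ Path N) length-vertices (spanning⇒≅Path T acyclic spans)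

  module _ {k} (n≡ : order T ≡ 3 * k + 1) where

    private
      n+ : ∀ j → order T + j ≡ 3 * k + suc j
      n+ j = trans (cong (_+ j) n≡) (ℕ.+-assoc (3 * k) 1 j)

      3*suc : 3 * suc k ≡ 3 * k + 3
      3*suc = trans (ℕ.*-suc 3 k) (ℕ.+-comm 3 (3 * k))

      -- From 3k + 1 there is room for two more vertices before ⌈n/3⌉ exceeds k + 1.
      short : ∀ {j} → j ≤ 2 → order T + j ≤ 3 * suc k
      short {j} j≤2 = ℕ.≤-trans (ℕ.≤-reflexive (n+ j))
        (ℕ.≤-trans (ℕ.+-monoʳ-≤ (3 * k) (s≤s j≤2)) (ℕ.≤-reflexive (sym 3*suc)))

      γ≡ : γ T ≡ suc k
      γ≡ = ℕ.≤-antisym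
        (γ≤ (ℕ.≤-trans (ℕ.≤-reflexive (sym (ℕ.+-identityʳ (order T)))) (short z≤n)))
        (ℕ.*-cancelˡ-< 3 k (γ T) (ℕ.≤-trans (ℕ.≤-reflexive (trans (ℕ.+-comm 1 (3 * k)) (sym n≡))) order≤3*γ))

      keeps : ∀ F → size F ≤ 2 → γ (subdivide T F) ≤ γ T
      keeps F F≤2 = ℕ.≤-trans (γ-subdivide≤ F (short F≤2)) (ℕ.≤-reflexive (sym γ≡))

      -- The subdivided path has 3k + 4 vertices, one more than k + 1 vertices can dominate.
      raises : ∀ F → size F ≡ 3 → γ T < γ (subdivide T F)
      raises F F≡3 = ℕ.≤-trans (s≤s (ℕ.≤-reflexive γ≡)) (γ-subdivide> F
        (ℕ.≤-reflexive (trans (cong suc 3*suc) (trans (sym (ℕ.+-suc (3 * k) 3))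
          (trans (sym (n+ 3)) (cong (order T +_) (sym F≡3)))))))

    critical : IsCritical 3 T
    critical = record
      { connected = connected
      ; order≥3   = order≥3
      ; increases = raises
      ; preserves = let F , F≡2 = edgesOfSize 2 (ℕ.n≤1+n 2) order≥3 in
          F , F≡2 , ℕ.≤-antisym (keeps F (ℕ.≤-reflexive F≡2)) (γ≤γ-subdivide T F)
      }

    subdivisionNumber : 1 ≤ k → SubdivisionNumber T 3
    subdivisionNumber 1≤k = (F , F≡3 , raises F F≡3) , least
      where
      4≤n : 4 ≤ order T
      4≤n = ℕ.≤-trans (ℕ.+-monoˡ-≤ 1 (ℕ.*-monoʳ-≤ 3 1≤k)) (ℕ.≤-reflexive (sym n≡))

      F   = edgesOfSize 3 ℕ.≤-refl 4≤n .proj₁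
      F≡3 = edgesOfSize 3 ℕ.≤-refl 4≤n .proj₂

      least : ∀ j → (Σ (EdgeSet T) λ F′ → size F′ ≡ j × γ T < γ (subdivide T F′)) → 3 ≤ j
      least j (F′ , refl , raised) = ℕ.≰⇒> λ j≤2 → ℕ.<⇒≱ raised (keeps F′ j≤2)

  -- One subdivision raises ⌈n/3⌉ when n = 3k, and two do when n = 3k + 2; only the residue 1
  -- remains, and there n ≥ 3 excludes k = 0.
  keep2⇒order : (∀ F → size F ≤ 2 → γ (subdivide T F) ≤ γ T) → ∃[ k ] 1 ≤ k × order T ≡ 3 * k + 1
  keep2⇒order keep with order T divMod 3
  ... | result k r n≡ = residue r (trans n≡ (trans (ℕ.+-comm (toℕ r) (k * 3)) (cong (_+ toℕ r) (ℕ.*-comm k 3))))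
    where
    tooLong : ∀ j m → j ≤ 2 → order T ≤ 3 * m → 3 * m < order T + j → ∃[ k ] 1 ≤ k × order T ≡ 3 * k + 1
    tooLong j m j≤2 n≤3m 3m<n+j with edgesOfSize j (ℕ.m≤n⇒m≤1+n j≤2) (ℕ.≤-trans (s≤s j≤2) order≥3)
    ... | F , refl = contradiction (ℕ.≤-trans (keep F j≤2) (γ≤ {m} n≤3m)) (ℕ.<⇒≱ (γ-subdivide> F {m} 3m<n+j))

    residue : ∀ (r : Fin 3) → order T ≡ 3 * k + toℕ r → ∃[ k ] 1 ≤ k × order T ≡ 3 * k + 1
    residue zero eq = tooLong 1 k (s≤s z≤n)
      (ℕ.≤-reflexive n≡3k) (ℕ.≤-reflexive (trans (cong suc (sym n≡3k)) (ℕ.+-comm 1 (order T))))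
      where n≡3k = trans eq (ℕ.+-identityʳ (3 * k))
    residue (suc zero) eq = k , positive k eq , eq
      where
      positive : ∀ k → order T ≡ 3 * k + 1 → 1 ≤ k
      positive zero    n≡1 = contradiction (subst (3 ≤_) n≡1 order≥3) λ { (s≤s ()) }
      positive (suc _) _   = s≤s z≤n
    residue (suc (suc zero)) eq = tooLong 2 (suc k) ℕ.≤-refl
      (ℕ.≤-trans (ℕ.n≤1+n _) (ℕ.≤-reflexive (sym 3k+3≡)))
      (ℕ.≤-reflexive (trans (cong suc 3k+3≡) (ℕ.+-comm 2 (order T))))
      where
      3k+3≡ : 3 * suc k ≡ suc (order T)
      3k+3≡ = trans (ℕ.*-suc 3 k) (trans (ℕ.+-comm 3 (3 * k)) (trans (ℕ.+-suc (3 * k) 2) (cong suc (sym eq))))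

theorem4p5 : (T : Graph) → IsTree T → 3 ≤ order T →
    (IsCritical 3 T × SubdivisionNumber T 3) ⇔ (∃[ k ] 1 ≤ k × (T ≅ Path (3 * k + 1)))
theorem4p5 T tree order≥3 = mk⇔ forward backward
  where
  open IsTree tree

  forward : IsCritical 3 T × SubdivisionNumber T 3 → ∃[ k ] 1 ≤ k × (T ≅ Path (3 * k + 1))
  forward (critical , _ , least) = let k , 1≤k , n≡ = keep2⇒order keep in
    k , 1≤k , subst (λ N → T ≅ Path N) n≡ ≅Path-order
    where
    keep : ∀ F → size F ≤ 2 → γ (subdivide T F) ≤ γ T
    -- Minimality of 3 among the sizes of edge sets that raise γ covers every set of at most two
    -- edges.
    keep F F≤2 = ℕ.≮⇒≥ λ raised → ℕ.<⇒≱ (s≤s F≤2) (least (size F) (F , refl , raised))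

    two : ∀ v → AtMostTwoNeighbours T v
    two v with atMostTwo⊎three T v
    ... | inj₁ atMost = atMost
    ... | inj₂ three  = contradiction three
      (Branches.increases⇒no-three T connected acyclic v
        (λ F F≡2 → keep F (ℕ.≤-reflexive F≡2)) (IsCritical.increases critical))

    open PathLike T tree order≥3 two

  backward : ∃[ k ] 1 ≤ k × (T ≅ Path (3 * k + 1)) → IsCritical 3 T × SubdivisionNumber T 3
  backward (k , 1≤k , iso) = critical {k} n≡ , subdivisionNumber n≡ 1≤k
    where
    n≡ = ≅Path⇒order T iso
    open PathLike T tree order≥3 (≅Path⇒atMostTwo T iso)
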